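{- Let $\mu\ge2$ and suppose the instance is $\mu$-impartial. Then Greedy with Rounded Values with parameter $\mu$ is $O(\log^2\mu)$-competitive, i.e., the optimal Nash welfare is at most $O(\log^2\mu)$ times the Nash welfare of the algorithm's allocation.
   Context: There are $N$ agents and $T$ divisible items arriving online in the order $t=1,\dots,T$. Item $t$ has supply $s_t>0$ and agent $i$ has value $v_{it}\ge 0$ per unit of item $t$. An allocation is a non-negative vector $(x_{it})$ with $\sum_{i} x_{it}\le s_t$; agent $i$'s utility is $u_i=\sum_t x_{it}v_{it}$, and the Nash welfare is $(\prod_{i=1}^N u_i)^{1/N}$. An allocation with utilities $(u_i)$ is $\mu$-impartial if $u_i\le\mu u_j$ for all $i,j$; an instance is $\mu$-impartial if every Nash welfare maximizing allocation is $\mu$-impartial. Myopic Greedy: for each arriving item $t$, choose $(x_{it})_i$ maximizing $\sum_{i=1}^N\log\big(\sum_{t'<t}v_{it'}x_{it'}+v_{it}x_{it}\big)$ subject to $\sum_i x_{it}\le s_t$, $x_{it}\ge0$. Greedy with Rounded Values with parameter $\mu$: let $L=\lceil\log_2\mu\rceil$. For each arriving item $t$, let $\bar v_t=\max_i v_{it}$ and create sub-items $(t,1),\dots,(t,L)$, each with supply $s_t/L$, where agent $i$'s value for sub-item $(t,j)$ is $\bar v_t/2^j$ if $v_{it}\ge\bar v_t/2^j$ and $0$ otherwise. The sub-items are fed, in the order $(1,1),\dots,(1,L),(2,1),\dots$, to Myopic Greedy, which allocates $x_{i(t,j)}$; agent $i$ then receives $x_{it}=\sum_{j=1}^Lx_{i(t,j)}$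 of item $t$.
   Formalization: Supplies, values, μ and allocations are rational rather than real; in Myopic Greedy, agents whose logarithm would be −∞ under every choice are left out of the objective. -}

module Defs where

open import Data.Nat as ℕ using (ℕ; zero; suc)
open import Data.Fin using (Fin; toℕ) renaming (zero to fzero; suc to fsuc)
open import Data.Integer using (+_)
open import Data.Rational using (ℚ; 0ℚ; 1ℚ; ½; _+_; _*_; _≤_; _<_; _⊔_; _/_)
open import Data.Rational.Properties using (_≤?_)
open import Data.Product using (_×_)
open import Relation.Nullary using (yes; no)
open import Relation.Nullary.Decidable using (⌊_⌋)
open import Data.Bool using (if_then_else_)

Σ : ∀ {n} → (Fin n → ℚ) → ℚ
Σ {zero}  f = 0ℚ
Σ {suc n} f = f fzero + Σ (λ k → f (fsuc k))

Π : ∀ {n} → (Fin n → ℚ) → ℚ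
Π {zero}  f = 1ℚ
Π {suc n} f = f fzero * Π (λ k → f (fsuc k))

-- maximum over Fin n (0 for the empty family; all values used are ≥ 0)
Max : ∀ {n} → (Fin n → ℚ) → ℚ
Max {zero}  f = 0ℚ
Max {suc n} f = f fzero ⊔ Max (λ k → f (fsuc k))

ΣBelow : ∀ {n} → Fin n → (Fin n → ℚ) → ℚ
ΣBelow m f = Σ (λ k → if ⌊ toℕ k ℕ.<? toℕ m ⌋ then f k else 0ℚ)

ΠWhere : ∀ {n} → (Fin n → ℚ) → (Fin n → ℚ) → ℚ
ΠWhere g f = Π (λ i → if ⌊ 0ℚ <? g i ⌋ then f i else 1ℚ)
  where open import Data.Rational.Properties using (_<?_)

ℕtoℚ : ℕ → ℚ
ℕtoℚ n = + n / 1

_^_ : ℚ → ℕ → ℚ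
q ^ zero  = 1ℚ
q ^ suc n = q * (q ^ n)

-- 1 / n for n ≥ 1 (0 for n = 0; only used with n ≥ 1)
recipℕ : ℕ → ℚ
recipℕ zero    = 0ℚ
recipℕ (suc n) = + 1 / suc n

-- Instances: N agents, T items, supplies s t > 0, values v i t ≥ 0.

record Instance (N T : ℕ) : Set where
  field
    s     : Fin T → ℚ
    v     : Fin N → Fin T → ℚ
    s-pos : ∀ t → 0ℚ < s t
    v-nonneg : ∀ i t → 0ℚ ≤ v i t

IsAllocation : ∀ {N T} → Instance N T → (Fin N → Fin T → ℚ) → Set
IsAllocation {N} {T} I x =
  (∀ i t → 0ℚ ≤ x i t) × (∀ t → Σ (λ i → x i t) ≤ Instance.s I t)

utility : ∀ {N T} → Instance N T → (Fin N → Fin T → ℚ) → Fin N → ℚ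
utility I x i = Σ (λ t → x i t * Instance.v I i t)

-- N-th power of the Nash welfare: ∏_i u_i
NWpow : ∀ {N T} → Instance N T → (Fin N → Fin T → ℚ) → ℚ
NWpow I x = Π (utility I x)

IsNWMaximizer : ∀ {N T} → Instance N T → (Fin N → Fin T → ℚ) → Set
IsNWMaximizer I x =
  IsAllocation I x × (∀ y → IsAllocation I y → NWpow I y ≤ NWpow I x)

Impartial : ∀ {N T} → ℚ → Instance N T → (Fin N → Fin T → ℚ) → Set
Impartial μ I x = ∀ i j → utility I x i ≤ μ * utility I x j

ImpartialInstance : ∀ {N T} → ℚ → Instance N T → Set
ImpartialInstance μ I = ∀ x → IsNWMaximizer I x → Impartial μ I x

IsCeilLog2 : ℚ → ℕ → Set
IsCeilLog2 μ L = (μ ≤ ℕtoℚ 2 ^ L) × (∀ k → μ ≤ ℕtoℚ 2 ^ k → L ℕ.≤ k)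

-- Myopic Greedy step: given prior utilities a i, values w i and supply σ,
-- y is a maximizer of Σ_i log(a i + w i y i) subject to y ≥ 0, Σ y ≤ σ.
-- Convention: log is maximized via the product, taken over the agents i
-- for which a i + w i σ > 0 (the other agents' terms are -∞ whatever is
-- chosen and do not influence the choice).

IsGreedyStep : ∀ {N} → (a w : Fin N → ℚ) → ℚ → (Fin N → ℚ) → Set
IsGreedyStep {N} a w σ y =
  Feasible y × (∀ y' → Feasible y' → obj y' ≤ obj y)
  where
  Feasible : (Fin N → ℚ) → Set
  Feasible z = (∀ i → 0ℚ ≤ z i) × (Σ z ≤ σ)
  obj : (Fin N → ℚ) → ℚ
  obj z = ΠWhere (λ i → a i + w i * σ) (λ i → a i + w i * z i)

-- Greedy with Rounded Values, parameter L = ⌈log₂ μ⌉.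
-- Sub-item (t , j) with j : Fin L stands for the paper's (t , j+1).

vbar : ∀ {N T} → Instance N T → Fin T → ℚ
vbar I t = Max (λ i → Instance.v I i t)

roundedValue : ∀ {N T} (I : Instance N T) (L : ℕ) → Fin N → Fin T → Fin L → ℚ
roundedValue I L i t j =
  if ⌊ thr ≤? Instance.v I i t ⌋ then thr else 0ℚ
  where thr = vbar I t * (½ ^ suc (toℕ j))

subSupply : ∀ {N T} → Instance N T → ℕ → Fin T → ℚ
subSupply I L t = Instance.s I t * recipℕ L

priorUtility : ∀ {N T} (I : Instance N T) (L : ℕ) →
               (Fin N → Fin T → Fin L → ℚ) → Fin N → Fin T → Fin L → ℚ
priorUtility I L z i t j =
    ΣBelow t (λ t' → Σ (λ j' → roundedValue I L i t' j' * z i t' j'))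
  + ΣBelow j (λ j' → roundedValue I L i t j' * z i t j')

IsRoundedGreedyRun : ∀ {N T} (I : Instance N T) (L : ℕ) →
                     (Fin N → Fin T → Fin L → ℚ) → Set
IsRoundedGreedyRun I L z =
  ∀ t j → IsGreedyStep (λ i → priorUtility I L z i t j)
                       (λ i → roundedValue I L i t j)
                       (subSupply I L t)
                       (λ i → z i t j)

roundedAllocation : ∀ {N T L} → (Fin N → Fin T → Fin L → ℚ) → Fin N → Fin T → ℚ
roundedAllocation z i t = Σ (λ j → z i t j)

{-# OPTIONS --safe #-}

-- Impartiality only speaks about exact maximizers of the Nash welfare, so one with rational entries is
-- needed. Among the assignments supported on a set S of agent-item pairs, either some direction inside S
-- helps without hurting anyone, and one can slide to a smaller support, or first-order optimality fixes the
-- ratios of the utilities along the components of the support graph, hence a rational stationary point, which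
-- is either feasible and optimal on S or lies beyond the boundary, where sliding towards it again shrinks S.
-- Induction on S yields a maximizer x up to double negation, which suffices as the claimed inequality is
-- decidable.
--
-- At x an agent i who receives part of t satisfies v k t · u i ≤ v i t · u k for all k, so by impartiality
-- v i t is at least 2⁻ᴸ times the maximal value, and giving each agent x i t / L of every sub-item of t loses
-- only a factor 2L. Greedy fills sub-items by water level: for a level c, the sub-items that some agent
-- ending at or below c wants are given out entirely below c, so the agents of final rounded utility
-- at most c have total optimal utility at most 2L · N · c. Splitting the agents into dyadic classes of optimal
-- utility, some agent among any n has n · u*ᵢ ≤ 2(L + 1) · 2L · N · uᵢ; removing agents one at a time
-- bounds N! ∏ u*ᵢ by (8 L² N)ᴺ ∏ uᵢ, and Nᴺ ≤ 4ᴺ N! finishes.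

module Submission where

open import Defs
open import Data.Nat as ℕ using (ℕ; zero; suc)
import Data.Nat.Properties as ℕP
open import Data.Fin using (Fin; toℕ; punchIn; punchOut) renaming (zero to fzero; suc to fsuc)
import Data.Fin.Properties as FinP
import Data.Integer as ℤ
import Data.Integer.Tactic.RingSolver as ℤSolver
open import Data.Rational hiding (floor)
open import Data.Rational.Properties
open import Data.Rational.Solver using (module +-*-Solver)
open +-*-Solver using (solve; _:=_; _:+_; _:*_; _:-_; :-_; con)
import Data.Rational.Unnormalised as ℚᵘ
import Data.Rational.Unnormalised.Properties as ℚᵘP
open import Data.Product using (Σ-syntax; ∃; _×_; _,_; proj₁; proj₂; map₂)
open import Data.Product.Properties using (≡-dec)
open import Data.Sum as Sum using (_⊎_; inj₁; inj₂)
open import Data.Empty using (⊥; ⊥-elim)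
open import Data.Bool using (Bool; true; false; if_then_else_; _∧_; not)
open import Data.List using (List; []; _∷_; filter; length; cartesianProduct; allFin)
open import Data.List.Properties using (filter-notAll)
open import Data.List.Membership.Propositional.Properties using (∈-cartesianProduct⁺; ∈-allFin; ∈-filter⁺)
open import Data.List.Relation.Unary.All as All using (All; []; _∷_)
open import Data.List.Relation.Unary.Any as Any using (here; there)
open import Function using (_∘_; case_of_)
open import Relation.Binary.Definitions using (Tri; tri<; tri≈; tri>)
open import Relation.Binary.PropositionalEquality
open import Relation.Nullary using (¬_; Dec; yes; no)
open import Relation.Nullary.Decidable using (⌊_⌋; ¬?; _×-dec_; ¬¬-excluded-middle; decidable-stable)

-- The two logarithms have separate origins. One factor `L` is lost by dividing each supply among
-- `L` sub-items; the other comes from pigeonholing optimal utilities, which impartiality confines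
-- to a range of ratio 2ᴸ, into `L + 1` dyadic classes. The classes are needed because the
-- water-level charge controls only the total optimal utility of the agents that end low, whereas a
-- product needs individual bounds; inside a class, total and individual are comparable up to 2. The
-- charge also carries a factor `N`, one cap per agent. Comparing it with the number of agents still
-- present, which runs through N, N - 1, ..., 1, turns it into Nᴺ / N!, which is only exponential.
-- For the maximizer the obstacle is that ℚ has no compactness, so it cannot be obtained as a limit.
-- A rational one exists because, once the support is fixed, stationarity is linear: the values on
-- the support edges dictate the ratios of utilities.

0≤1 : 0ℚ ≤ 1ℚ
0≤1 = nonNegative⁻¹ 1ℚ

0<1 : 0ℚ < 1ℚ
0<1 = positive⁻¹ 1ℚ

*-monoˡ : ∀ {c a b} → 0ℚ ≤ c → a ≤ b → c * a ≤ c * b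
*-monoˡ {c} 0≤c = *-monoˡ-≤-nonNeg c {{nonNegative 0≤c}}

*-monoʳ : ∀ {c a b} → 0ℚ ≤ c → a ≤ b → a * c ≤ b * c
*-monoʳ {c} 0≤c = *-monoʳ-≤-nonNeg c {{nonNegative 0≤c}}

*-mono : ∀ {a b c d} → 0ℚ ≤ a → 0ℚ ≤ d → a ≤ b → c ≤ d → a * c ≤ b * d
*-mono 0≤a 0≤d a≤b c≤d = ≤-trans (*-monoˡ 0≤a c≤d) (*-monoʳ 0≤d a≤b)

*-nonneg : ∀ {a b} → 0ℚ ≤ a → 0ℚ ≤ b → 0ℚ ≤ a * b
*-nonneg {a} {b} 0≤a 0≤b =
  nonNegative⁻¹ (a * b) {{nonNeg*nonNeg⇒nonNeg a {{nonNegative 0≤a}} b {{nonNegative 0≤b}}}}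

*-pos : ∀ {a b} → 0ℚ < a → 0ℚ < b → 0ℚ < a * b
*-pos {a} {b} 0<a 0<b =
  positive⁻¹ (a * b) {{pos*pos⇒pos a {{positive 0<a}} b {{positive 0<b}}}}

+-nonneg : ∀ {a b} → 0ℚ ≤ a → 0ℚ ≤ b → 0ℚ ≤ a + b
+-nonneg = +-mono-≤

*-cancelˡ-≤ : ∀ {c a b} → 0ℚ < c → c * a ≤ c * b → a ≤ b
*-cancelˡ-≤ {c} 0<c = *-cancelˡ-≤-pos c {{positive 0<c}}

*-cancelˡ-< : ∀ {c a b} → 0ℚ ≤ c → c * a < c * b → a < b
*-cancelˡ-< {c} 0≤c = *-cancelˡ-<-nonNeg c {{nonNegative 0≤c}}

*-monoˡ-< : ∀ {c a b} → 0ℚ < c → a < b → c * a < c * b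
*-monoˡ-< {c} 0<c = *-monoʳ-<-pos c {{positive 0<c}}

≤-split : ∀ {p q} → p ≤ q → p < q ⊎ p ≡ q
≤-split {p} {q} p≤q with p <? q
... | yes p<q = inj₁ p<q
... | no p≮q = inj₂ (≤-antisym p≤q (≮⇒≥ p≮q))

a≤a+r : ∀ {a r} → 0ℚ ≤ r → a ≤ a + r
a≤a+r {a} {r} 0≤r = subst (_≤ a + r) (+-identityʳ a) (+-monoʳ-≤ a 0≤r)

a<a+r : ∀ {a r} → 0ℚ < r → a < a + r
a<a+r {a} {r} 0<r = subst (_< a + r) (+-identityʳ a) (+-monoʳ-< a 0<r)

≤-by : ∀ {p q} r → 0ℚ ≤ r → q ≡ p + r → p ≤ q
≤-by r 0≤r refl = a≤a+r 0≤r

<-by : ∀ {p q} r → 0ℚ < r → q ≡ p + r → p < q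
<-by r 0<r refl = a<a+r 0<r

≤⇒0≤- : ∀ {p q} → p ≤ q → 0ℚ ≤ q - p
≤⇒0≤- {p} {q} p≤q = subst (_≤ q - p) (+-inverseʳ p) (+-monoˡ-≤ (- p) p≤q)

<⇒0<- : ∀ {p q} → p < q → 0ℚ < q - p
<⇒0<- {p} {q} p<q = subst (_< q - p) (+-inverseʳ p) (+-monoˡ-< (- p) p<q)

inverse : ∀ {a} → 0ℚ < a → Σ[ b ∈ ℚ ] (0ℚ < b × a * b ≡ 1ℚ)
inverse {a} 0<a =
  1/_ a {{nz}} , positive⁻¹ (1/_ a {{nz}}) {{1/pos⇒pos a {{positive 0<a}}}} , *-inverseʳ a {{nz}}
  where
  nz : NonZero a
  nz = pos⇒nonZero a {{positive 0<a}}

ℕtoℚ-suc : ∀ n → ℕtoℚ (suc n) ≡ 1ℚ + ℕtoℚ n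
ℕtoℚ-suc n = toℚᵘ-injective (ℚᵘP.≃-trans (toℚᵘ-fromℚᵘ _) (ℚᵘP.≃-trans (aux n)
    (ℚᵘP.≃-sym (ℚᵘP.≃-trans (toℚᵘ-homo-+ 1ℚ (ℕtoℚ n)) (ℚᵘP.+-congʳ (toℚᵘ 1ℚ) (toℚᵘ-fromℚᵘ (ℚᵘ.mkℚᵘ (ℤ.+ n) 0)))))))
  where
  ring : ∀ i → (ℤ.+ 1 ℤ.+ i) ℤ.* (ℤ.+ 1) ≡ (ℤ.+ 1 ℤ.* ℤ.+ 1 ℤ.+ i ℤ.* ℤ.+ 1) ℤ.* ℤ.+ 1
  ring = ℤSolver.solve-∀
  aux : ∀ n → ℚᵘ.mkℚᵘ (ℤ.+ suc n) 0 ℚᵘ.≃ (toℚᵘ 1ℚ ℚᵘ.+ ℚᵘ.mkℚᵘ (ℤ.+ n) 0)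
  aux n = ℚᵘ.*≡* (ring (ℤ.+ n))

abstract
  -- Abstract, since the normal form of + suc n / 1 for a variable n is huge.
  ι : ℕ → ℚ
  ι = ℕtoℚ

  ι≡ℕtoℚ : ∀ n → ι n ≡ ℕtoℚ n
  ι≡ℕtoℚ n = refl

  ι-zero : ι 0 ≡ 0ℚ
  ι-zero = refl

  ι-suc : ∀ n → ι (suc n) ≡ 1ℚ + ι n
  ι-suc = ℕtoℚ-suc

ι-nonneg : ∀ n → 0ℚ ≤ ι n
ι-nonneg zero    = ≤-reflexive (sym ι-zero)
ι-nonneg (suc n) = subst (0ℚ ≤_) (sym (ι-suc n)) (+-nonneg 0≤1 (ι-nonneg n))

ι-pos : ∀ n → 0ℚ < ι (suc n)
ι-pos n = subst (0ℚ <_) (sym (ι-suc n)) (<-≤-trans 0<1 (a≤a+r (ι-nonneg n)))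

-- Finite sums and products

δ : ∀ {n} → Fin n → Fin n → ℚ
δ fzero    fzero    = 1ℚ
δ fzero    (fsuc j) = 0ℚ
δ (fsuc i) fzero    = 0ℚ
δ (fsuc i) (fsuc j) = δ i j

δ-refl : ∀ {n} (i : Fin n) → δ i i ≡ 1ℚ
δ-refl fzero    = refl
δ-refl (fsuc i) = δ-refl i

δ-nonneg : ∀ {n} (i j : Fin n) → 0ℚ ≤ δ i j
δ-nonneg fzero    fzero    = 0≤1
δ-nonneg fzero    (fsuc j) = ≤-refl
δ-nonneg (fsuc i) fzero    = ≤-refl
δ-nonneg (fsuc i) (fsuc j) = δ-nonneg i j

δ-≢ : ∀ {n} {i j : Fin n} → i ≢ j → δ i j ≡ 0ℚ
δ-≢ {i = fzero}  {fzero}  h = ⊥-elim (h refl)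
δ-≢ {i = fzero}  {fsuc j} h = refl
δ-≢ {i = fsuc i} {fzero}  h = refl
δ-≢ {i = fsuc i} {fsuc j} h = δ-≢ (h ∘ cong fsuc)

Σ-cong : ∀ {n} {f g : Fin n → ℚ} → (∀ i → f i ≡ g i) → Σ f ≡ Σ g
Σ-cong {zero}  h = refl
Σ-cong {suc n} h = cong₂ _+_ (h fzero) (Σ-cong (h ∘ fsuc))

Σ-mono : ∀ {n} {f g : Fin n → ℚ} → (∀ i → f i ≤ g i) → Σ f ≤ Σ g
Σ-mono {zero}  h = ≤-refl
Σ-mono {suc n} h = +-mono-≤ (h fzero) (Σ-mono (h ∘ fsuc))

Σ-0 : ∀ n → Σ {n} (λ _ → 0ℚ) ≡ 0ℚ
Σ-0 zero    = refl
Σ-0 (suc n) = trans (+-identityˡ _) (Σ-0 n)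

Σ-zero : ∀ {n} {f : Fin n → ℚ} → (∀ i → f i ≡ 0ℚ) → Σ f ≡ 0ℚ
Σ-zero {n} h = trans (Σ-cong h) (Σ-0 n)

Σ-nonneg : ∀ {n} {f : Fin n → ℚ} → (∀ i → 0ℚ ≤ f i) → 0ℚ ≤ Σ f
Σ-nonneg {n} {f} h = subst (_≤ Σ f) (Σ-0 n) (Σ-mono h)

Σ-+ : ∀ {n} (f g : Fin n → ℚ) → Σ (λ i → f i + g i) ≡ Σ f + Σ g
Σ-+ {zero}  f g = refl
Σ-+ {suc n} f g = trans (cong (f fzero + g fzero +_) (Σ-+ (f ∘ fsuc) (g ∘ fsuc)))
  (solve 4 (λ a b c d → a :+ b :+ (c :+ d) := a :+ c :+ (b :+ d)) refl
    (f fzero) (g fzero) (Σ (f ∘ fsuc)) (Σ (g ∘ fsuc)))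

Σ-*ˡ : ∀ {n} c (f : Fin n → ℚ) → Σ (λ i → c * f i) ≡ c * Σ f
Σ-*ˡ {zero}  c f = sym (*-zeroʳ c)
Σ-*ˡ {suc n} c f = trans (cong (c * f fzero +_) (Σ-*ˡ c (f ∘ fsuc)))
  (sym (*-distribˡ-+ c (f fzero) (Σ (f ∘ fsuc))))

Σ-*ʳ : ∀ {n} c (f : Fin n → ℚ) → Σ (λ i → f i * c) ≡ Σ f * c
Σ-*ʳ c f = trans (Σ-cong (λ i → *-comm (f i) c)) (trans (Σ-*ˡ c f) (*-comm c (Σ f)))

Σ-neg : ∀ {n} (f : Fin n → ℚ) → Σ (λ i → - f i) ≡ - Σ f
Σ-neg {zero}  f = refl
Σ-neg {suc n} f = trans (cong (- f fzero +_) (Σ-neg (f ∘ fsuc))) (sym (neg-distrib-+ (f fzero) (Σ (f ∘ fsuc))))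

Σ-- : ∀ {n} (f g : Fin n → ℚ) → Σ (λ i → f i - g i) ≡ Σ f - Σ g
Σ-- f g = trans (Σ-+ f (λ i → - g i)) (cong (Σ f +_) (Σ-neg g))

Σ-swap : ∀ {m n} (f : Fin m → Fin n → ℚ) → Σ (λ i → Σ (λ j → f i j)) ≡ Σ (λ j → Σ (λ i → f i j))
Σ-swap {zero}  {n} f = sym (Σ-0 n)
Σ-swap {suc m} f = trans (cong (Σ (f fzero) +_) (Σ-swap (f ∘ fsuc)))
  (sym (Σ-+ (f fzero) (λ j → Σ (λ i → f (fsuc i) j))))

Σ-const : ∀ n c → Σ {n} (λ _ → c) ≡ ι n * c
Σ-const zero    c = sym (trans (cong (_* c) ι-zero) (*-zeroˡ c))
Σ-const (suc n) c = trans (cong (c +_) (Σ-const n c)) (trans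
  (solve 2 (λ c n → c :+ n :* c := (con 1ℚ :+ n) :* c) refl c (ι n))
  (cong (_* c) (sym (ι-suc n))))

Σ-δ : ∀ {n} (k : Fin n) (f : Fin n → ℚ) → Σ (λ i → δ k i * f i) ≡ f k
Σ-δ fzero f = trans (cong₂ _+_ (*-identityˡ (f fzero)) (Σ-zero (λ i → *-zeroˡ (f (fsuc i))))) (+-identityʳ _)
Σ-δ (fsuc k) f = trans (cong₂ _+_ (*-zeroˡ (f fzero)) (Σ-δ k (f ∘ fsuc))) (+-identityˡ _)

δ-sym : ∀ {n} (i j : Fin n) → δ i j ≡ δ j i
δ-sym fzero    fzero    = refl
δ-sym fzero    (fsuc j) = refl
δ-sym (fsuc i) fzero    = refl
δ-sym (fsuc i) (fsuc j) = δ-sym i j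

term≤Σ : ∀ {n} {f : Fin n → ℚ} → (∀ i → 0ℚ ≤ f i) → ∀ k → f k ≤ Σ f
term≤Σ {f = f} h fzero = a≤a+r (Σ-nonneg (h ∘ fsuc))
term≤Σ {f = f} h (fsuc k) = ≤-trans (term≤Σ (h ∘ fsuc) k)
  (≤-by (f fzero) (h fzero) (+-comm (f fzero) (Σ (f ∘ fsuc))))

Σ-punchIn : ∀ {n} (i : Fin (suc n)) (f : Fin (suc n) → ℚ) → Σ f ≡ f i + Σ (f ∘ punchIn i)
Σ-punchIn fzero f = refl
Σ-punchIn {suc n} (fsuc i) f = trans (cong (f fzero +_) (Σ-punchIn i (f ∘ fsuc)))
  (solve 3 (λ a b c → a :+ (b :+ c) := b :+ (a :+ c)) refl (f fzero) (f (fsuc i)) (Σ (f ∘ fsuc ∘ punchIn i)))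

Π-cong : ∀ {n} {f g : Fin n → ℚ} → (∀ i → f i ≡ g i) → Π f ≡ Π g
Π-cong {zero}  h = refl
Π-cong {suc n} h = cong₂ _*_ (h fzero) (Π-cong (h ∘ fsuc))

Π-nonneg : ∀ {n} {f : Fin n → ℚ} → (∀ i → 0ℚ ≤ f i) → 0ℚ ≤ Π f
Π-nonneg {zero}  h = 0≤1
Π-nonneg {suc n} h = *-nonneg (h fzero) (Π-nonneg (h ∘ fsuc))

Π-pos : ∀ {n} {f : Fin n → ℚ} → (∀ i → 0ℚ < f i) → 0ℚ < Π f
Π-pos {zero}  h = 0<1
Π-pos {suc n} h = *-pos (h fzero) (Π-pos (h ∘ fsuc))

Π-mono : ∀ {n} {f g : Fin n → ℚ} → (∀ i → 0ℚ ≤ f i) → (∀ i → f i ≤ g i) → Π f ≤ Π g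
Π-mono {zero}  0≤f h = ≤-refl
Π-mono {suc n} 0≤f h = *-mono (0≤f fzero) (Π-nonneg (λ i → ≤-trans (0≤f (fsuc i)) (h (fsuc i))))
  (h fzero) (Π-mono (0≤f ∘ fsuc) (h ∘ fsuc))

Π-* : ∀ {n} (f g : Fin n → ℚ) → Π (λ i → f i * g i) ≡ Π f * Π g
Π-* {zero}  f g = refl
Π-* {suc n} f g = trans (cong (f fzero * g fzero *_) (Π-* (f ∘ fsuc) (g ∘ fsuc)))
  (solve 4 (λ a b c d → a :* b :* (c :* d) := a :* c :* (b :* d)) refl
    (f fzero) (g fzero) (Π (f ∘ fsuc)) (Π (g ∘ fsuc)))

Π-const : ∀ n c → Π {n} (λ _ → c) ≡ c ^ n
Π-const zero    c = refl
Π-const (suc n) c = cong (c *_) (Π-const n c)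

Π-punchIn : ∀ {n} (i : Fin (suc n)) (f : Fin (suc n) → ℚ) → Π f ≡ f i * Π (f ∘ punchIn i)
Π-punchIn fzero f = refl
Π-punchIn {suc n} (fsuc i) f = trans (cong (f fzero *_) (Π-punchIn i (f ∘ fsuc)))
  (solve 3 (λ a b c → a :* (b :* c) := b :* (a :* c)) refl (f fzero) (f (fsuc i)) (Π (f ∘ fsuc ∘ punchIn i)))

Π>0⇒factor>0 : ∀ {n} {f : Fin n → ℚ} → (∀ i → 0ℚ ≤ f i) → 0ℚ < Π f → ∀ i → 0ℚ < f i
Π>0⇒factor>0 {suc n} {f} 0≤f Π>0 i with ≤-split (0≤f i)
... | inj₁ 0<fi = 0<fi
... | inj₂ 0≡fi = ⊥-elim (<-irrefl (sym (trans (Π-punchIn i f)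
        (trans (cong (_* Π (f ∘ punchIn i)) (sym 0≡fi)) (*-zeroˡ (Π (f ∘ punchIn i)))))) Π>0)

^-nonneg : ∀ {c} → 0ℚ ≤ c → ∀ n → 0ℚ ≤ c ^ n
^-nonneg 0≤c zero    = 0≤1
^-nonneg 0≤c (suc n) = *-nonneg 0≤c (^-nonneg 0≤c n)

^-pos : ∀ {c} → 0ℚ < c → ∀ n → 0ℚ < c ^ n
^-pos 0<c zero    = 0<1
^-pos 0<c (suc n) = *-pos 0<c (^-pos 0<c n)

^-*-distrib : ∀ a b n → (a * b) ^ n ≡ a ^ n * b ^ n
^-*-distrib a b zero    = refl
^-*-distrib a b (suc n) = trans (cong (a * b *_) (^-*-distrib a b n))
  (solve 4 (λ a b c d → a :* b :* (c :* d) := a :* c :* (b :* d)) refl a b (a ^ n) (b ^ n))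

argmin : ∀ {n} (f : Fin (suc n) → ℚ) → Σ[ i ∈ Fin (suc n) ] (∀ j → f i ≤ f j)
argmin {zero}  f = fzero , λ { fzero → ≤-refl }
argmin {suc n} f with argmin (f ∘ fsuc)
... | i , h with ≤-total (f fzero) (f (fsuc i))
...   | inj₁ le = fzero , λ { fzero → ≤-refl ; (fsuc j) → ≤-trans le (h j) }
...   | inj₂ ge = fsuc i , λ { fzero → ge ; (fsuc j) → h j }

-- The inequality of arithmetic and geometric means

square-nonneg : ∀ a → 0ℚ ≤ a * a
square-nonneg a with ≤-total 0ℚ a
... | inj₁ 0≤a = *-nonneg 0≤a 0≤a
... | inj₂ a≤0 = subst (0ℚ ≤_) (solve 1 (λ a → (:- a) :* (:- a) := a :* a) refl a)
      (*-nonneg (neg-antimono-≤ a≤0) (neg-antimono-≤ a≤0))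

ι-one : ι 1 ≡ 1ℚ
ι-one = trans (ι-suc 0) (cong (1ℚ +_) ι-zero)

-- Bernoulli's inequality in homogeneous form. The induction multiplies by `X`, and the discrepancy
-- is the square term `k * P * ((X - A) * (X - A))`.
^-tangent : ∀ n {X A} → 0ℚ ≤ X → 0ℚ ≤ A →
  A ^ suc n + ι (suc n) * A ^ n * (X - A) ≤ X ^ suc n
^-tangent zero {X} {A} 0≤X 0≤A = ≤-reflexive (trans
  (cong (λ k → A * 1ℚ + k * 1ℚ * (X - A)) ι-one)
  (solve 2 (λ X A → A :* con 1ℚ :+ con 1ℚ :* con 1ℚ :* (X :- A) := X :* con 1ℚ) refl X A))
^-tangent (suc n) {X} {A} 0≤X 0≤A = ≤-trans
  (≤-by (k * P * ((X - A) * (X - A)))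
    (*-nonneg (*-nonneg (ι-nonneg (suc n)) (^-nonneg 0≤A n)) (square-nonneg (X - A)))
    (trans (solve 4 (λ X A P k →
        X :* (A :* P :+ k :* P :* (X :- A)) :=
        A :* (A :* P) :+ (con 1ℚ :+ k) :* (A :* P) :* (X :- A) :+ k :* P :* ((X :- A) :* (X :- A)))
        refl X A P k)
      (cong (λ m → A * (A * P) + m * (A * P) * (X - A) + k * P * ((X - A) * (X - A)))
        (sym (ι-suc (suc n))))))
  (*-monoˡ 0≤X (^-tangent n 0≤X 0≤A))
  where
  k = ι (suc n)
  P = A ^ n

Σ-mean : ∀ {n} {f : Fin n → ℚ} → (∀ i → 0ℚ ≤ f i) → Σ[ a ∈ ℚ ] (0ℚ ≤ a × Σ f ≡ ι n * a)
Σ-mean {zero}  0≤f = 0ℚ , ≤-refl , sym (*-zeroʳ (ι 0))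
Σ-mean {suc n} {f} 0≤f with inverse (ι-pos n)
... | b , 0<b , kb≡1 = b * Σ f , *-nonneg (<⇒≤ 0<b) (Σ-nonneg 0≤f) ,
  trans (sym (*-identityˡ (Σ f))) (trans (cong (_* Σ f) (sym kb≡1)) (*-assoc (ι (suc n)) b (Σ f)))

-- No roots occur: with `c` the mean of the other `n` numbers, `b * c ^ n` equals
-- `c ^ suc n + c ^ n * (b - c)`. The sum bound gives `b - c ≤ k * (a - c)`, so this is at most the
-- tangent of the power `suc n` at `c`, evaluated at `a`.
AM-GM : ∀ {n} {f : Fin n → ℚ} {a} → (∀ i → 0ℚ ≤ f i) → 0ℚ ≤ a → Σ f ≤ ι n * a → Π f ≤ a ^ n
AM-GM {zero}  0≤f 0≤a h = ≤-refl
AM-GM {suc n} {f} {a} 0≤f 0≤a h with Σ-mean (0≤f ∘ fsuc)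
... | c , 0≤c , Σ≡ = begin
  b * Π (f ∘ fsuc)                           ≤⟨ *-monoˡ (0≤f fzero) (AM-GM (0≤f ∘ fsuc) 0≤c (≤-reflexive Σ≡)) ⟩
  b * c ^ n                                  ≡⟨ solve 3 (λ b c P → b :* P := c :* P :+ P :* (b :- c)) refl b c (c ^ n) ⟩
  c * c ^ n + c ^ n * (b - c)                ≤⟨ +-monoʳ-≤ (c * c ^ n) (*-monoˡ (^-nonneg 0≤c n) b-c≤) ⟩
  c * c ^ n + c ^ n * (k * (a - c))          ≡⟨ solve 4 (λ a c P k → c :* P :+ P :* (k :* (a :- c)) := c :* P :+ k :* P :* (a :- c)) refl a c (c ^ n) k ⟩
  c ^ suc n + k * c ^ n * (a - c)            ≤⟨ ^-tangent n 0≤a 0≤c ⟩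
  a ^ suc n                                  ∎
  where
  open ≤-Reasoning
  b = f fzero
  k = ι (suc n)
  m = ι n
  b-c≤ : b - c ≤ k * (a - c)
  b-c≤ = begin
    b - c                    ≡⟨ solve 3 (λ b c m → b :- c := b :+ m :* c :- (con 1ℚ :+ m) :* c) refl b c m ⟩
    b + m * c - (1ℚ + m) * c ≡⟨ cong₂ (λ x y → b + x - y * c) (sym Σ≡) (sym (ι-suc n)) ⟩
    Σ f - k * c              ≤⟨ +-monoˡ-≤ (- (k * c)) h ⟩
    k * a - k * c            ≡⟨ solve 3 (λ k a c → k :* a :- k :* c := k :* (a :- c)) refl k a c ⟩
    k * (a - c)              ∎

1^ : ∀ n → 1ℚ ^ n ≡ 1ℚ
1^ zero    = refl
1^ (suc n) = trans (*-identityˡ (1ℚ ^ n)) (1^ n)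

AM-GM₁ : ∀ {n} {f : Fin n → ℚ} → (∀ i → 0ℚ ≤ f i) → Σ f ≤ ι n → Π f ≤ 1ℚ
AM-GM₁ {n} {f} 0≤f h = subst (Π f ≤_) (1^ n)
  (AM-GM 0≤f 0≤1 (subst (Σ f ≤_) (sym (*-identityʳ (ι n))) h))

fact : ℕ → ℚ
fact zero    = 1ℚ
fact (suc n) = ι (suc n) * fact n

fact-pos : ∀ n → 0ℚ < fact n
fact-pos zero    = 0<1
fact-pos (suc n) = *-pos (ι-pos n) (fact-pos n)

4ℚ : ℚ
4ℚ = 1ℚ + 1ℚ + 1ℚ + 1ℚ

0≤4 : 0ℚ ≤ 4ℚ
0≤4 = nonNegative⁻¹ 4ℚ

-- AM-GM for the n + 2 numbers ½, ½, (n+1)/n, …, (n+1)/n.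
suc^≤4*^ : ∀ n → ι (suc n) ^ n ≤ 4ℚ * ι n ^ n
suc^≤4*^ zero    = ≤-by (1ℚ + 1ℚ + 1ℚ) (nonNegative⁻¹ _) refl
suc^≤4*^ (suc p) with inverse (ι-pos p)
... | b , 0<b , cb≡1 = begin
  k ^ n                           ≡⟨ cong (_^ n) k≡cr ⟩
  (c * r) ^ n                     ≡⟨ ^-*-distrib c r n ⟩
  c ^ n * r ^ n                   ≡⟨ solve 2 (λ x y → x :* y := con 4ℚ :* x :* (con ½ :* (con ½ :* y))) refl (c ^ n) (r ^ n) ⟩
  4ℚ * c ^ n * (½ * (½ * r ^ n))  ≤⟨ *-monoˡ (*-nonneg 0≤4 (^-nonneg (ι-nonneg n) n))
                                       (subst (λ x → ½ * (½ * x) ≤ 1ℚ) (Π-const n r) (AM-GM₁ 0≤f Σf≤)) ⟩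
  4ℚ * c ^ n * 1ℚ                 ≡⟨ *-identityʳ _ ⟩
  4ℚ * c ^ n                      ∎
  where
  open ≤-Reasoning
  n = suc p
  c = ι n
  k = ι (suc n)
  r = k * b
  k≡cr : k ≡ c * r
  k≡cr = trans (sym (*-identityʳ k)) (trans (cong (k *_) (sym cb≡1))
    (solve 3 (λ c k b → k :* (c :* b) := c :* (k :* b)) refl c k b))
  f : Fin (suc (suc n)) → ℚ
  f fzero           = ½
  f (fsuc fzero)    = ½
  f (fsuc (fsuc _)) = r
  0≤f : ∀ i → 0ℚ ≤ f i
  0≤f fzero           = nonNegative⁻¹ ½
  0≤f (fsuc fzero)    = nonNegative⁻¹ ½
  0≤f (fsuc (fsuc _)) = *-nonneg (ι-nonneg (suc n)) (<⇒≤ 0<b)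
  Σf≤ : Σ f ≤ ι (suc (suc n))
  Σf≤ = ≤-reflexive (trans (cong (λ x → ½ + (½ + x)) (trans (Σ-const n r) (sym k≡cr)))
    (trans (solve 1 (λ k → con ½ :+ (con ½ :+ k) := con 1ℚ :+ k) refl k) (sym (ι-suc (suc n)))))

n^n≤4^n*n! : ∀ n → ι n ^ n ≤ 4ℚ ^ n * fact n
n^n≤4^n*n! zero    = ≤-refl
n^n≤4^n*n! (suc n) = begin
  k * k ^ n                     ≤⟨ *-monoˡ 0≤k (suc^≤4*^ n) ⟩
  k * (4ℚ * ι n ^ n)         ≤⟨ *-monoˡ 0≤k (*-monoˡ 0≤4 (n^n≤4^n*n! n)) ⟩
  k * (4ℚ * (4ℚ ^ n * fact n))  ≡⟨ solve 4 (λ k f p q → k :* (f :* (p :* q)) := f :* p :* (k :* q)) refl k 4ℚ (4ℚ ^ n) (fact n) ⟩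
  4ℚ * 4ℚ ^ n * (k * fact n)    ∎
  where
  open ≤-Reasoning
  k = ι (suc n)
  0≤k = ι-nonneg (suc n)

2ℚ : ℚ
2ℚ = 1ℚ + 1ℚ

0<2 : 0ℚ < 2ℚ
0<2 = positive⁻¹ 2ℚ

-- Ranks and dyadic weight classes

-- In the application `w` is optimal utility and `u` is the rounded utility greedy produces, so this
-- is the optimal utility held by agents that end at or below the level `λ₀`.
rankWeight : ∀ {n} → (w u : Fin n → ℚ) → ℚ → ℚ
rankWeight w u λ₀ = Σ (λ k → if ⌊ u k ≤? λ₀ ⌋ then w k else 0ℚ)

χ : Bool → ℚ
χ b = if b then 1ℚ else 0ℚ

count : ∀ {n} → (Fin n → Bool) → ℚ
count S = Σ (χ ∘ S)

argmaxOn : ∀ {n} (S : Fin n → Bool) (u : Fin n → ℚ) →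
  (∀ i → S i ≡ false) ⊎ (Σ[ i ∈ Fin n ] (S i ≡ true × (∀ k → S k ≡ true → u k ≤ u i)))
argmaxOn {zero} S u = inj₁ λ ()
argmaxOn {suc n} S u with S fzero in S0 | argmaxOn (S ∘ fsuc) (u ∘ fsuc)
... | false | inj₁ none = inj₁ λ { fzero → S0 ; (fsuc i) → none i }
... | false | inj₂ (i , Si , max) = inj₂ (fsuc i , Si ,
        λ { fzero Sk → case trans (sym S0) Sk of λ () ; (fsuc k) Sk → max k Sk })
... | true | inj₁ none = inj₂ (fzero , S0 ,
        λ { fzero _ → ≤-refl ; (fsuc k) Sk → case trans (sym (none k)) Sk of λ () })
... | true | inj₂ (i , Si , max) with ≤-total (u fzero) (u (fsuc i))
...   | inj₁ le = inj₂ (fsuc i , Si , λ { fzero _ → le ; (fsuc k) Sk → max k Sk })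
...   | inj₂ ge = inj₂ (fzero , S0 , λ { fzero _ → ≤-refl ; (fsuc k) Sk → ≤-trans (max k Sk) ge })

-- All of `S` lies at or below the level `u i`, so the rank weight there is at least `m * q`;
-- allowing `w i` up to twice `m` costs the factor 2.
heavyRank-max : ∀ {n} (w u : Fin n → ℚ) (S : Fin n → Bool) {m q i} →
  (∀ k → 0ℚ ≤ w k) → 0ℚ ≤ m → 0ℚ ≤ q →
  (∀ k → S k ≡ true → m ≤ w k) → q ≤ count S → w i ≤ 2ℚ * m →
  (∀ k → S k ≡ true → u k ≤ u i) → q * w i ≤ 2ℚ * rankWeight w u (u i)
heavyRank-max w u S {m} {q} {i} 0≤w 0≤m 0≤q m≤w q≤S wi≤ max = begin
  q * w i                     ≤⟨ *-monoˡ 0≤q wi≤ ⟩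
  q * (2ℚ * m)                ≡⟨ solve 2 (λ q m → q :* (con 2ℚ :* m) := con 2ℚ :* (m :* q)) refl q m ⟩
  2ℚ * (m * q)                ≤⟨ *-monoˡ (<⇒≤ 0<2) (*-monoˡ 0≤m q≤S) ⟩
  2ℚ * (m * count S)          ≡⟨ cong (2ℚ *_) (sym (Σ-*ˡ m (χ ∘ S))) ⟩
  2ℚ * Σ (λ k → m * χ (S k))  ≤⟨ *-monoˡ (<⇒≤ 0<2) (Σ-mono pointwise) ⟩
  2ℚ * rankWeight w u (u i)   ∎
  where
  open ≤-Reasoning
  pointwise : ∀ k → m * χ (S k) ≤ (if ⌊ u k ≤? u i ⌋ then w k else 0ℚ)
  pointwise k with S k in Sk | u k ≤? u i
  ... | true  | yes _ = ≤-trans (≤-reflexive (*-identityʳ m)) (m≤w k Sk)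
  ... | true  | no ¬p = ⊥-elim (¬p (max k Sk))
  ... | false | yes _ = ≤-trans (≤-reflexive (*-zeroʳ m)) (0≤w k)
  ... | false | no _  = ≤-reflexive (*-zeroʳ m)

count-split : ∀ {n} (S B : Fin n → Bool) →
  count S ≡ count (λ i → S i ∧ B i) + count (λ i → S i ∧ not (B i))
count-split S B = trans (Σ-cong split) (Σ-+ (λ i → χ (S i ∧ B i)) (λ i → χ (S i ∧ not (B i))))
  where
  split : ∀ i → χ (S i) ≡ χ (S i ∧ B i) + χ (S i ∧ not (B i))
  split i with S i | B i
  ... | true  | true  = refl
  ... | true  | false = refl
  ... | false | _     = refl

-- Some dyadic weight class [m·2ᶜ, m·2ᶜ⁺¹) has at least q members; take its member of largest u.
heavyRank : ∀ L {n} (w u : Fin n → ℚ) (S : Fin n → Bool) {m q} →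
  (∀ k → 0ℚ ≤ w k) → 0ℚ < m → 0ℚ < q →
  (∀ k → S k ≡ true → m ≤ w k × w k < 2ℚ ^ L * m) → ι L * q ≤ count S → 0ℚ < count S →
  Σ[ i ∈ Fin n ] (q * w i ≤ 2ℚ * rankWeight w u (u i))
heavyRank zero w u S {m} 0≤w 0<m 0<q range _ 0<S with argmaxOn S u
... | inj₁ none = ⊥-elim (<-irrefl (sym (Σ-zero (λ i → cong χ (none i)))) 0<S)
... | inj₂ (i , Si , _) = ⊥-elim (<-irrefl (sym (*-identityˡ m))
        (≤-<-trans (proj₁ (range i Si)) (proj₂ (range i Si))))
heavyRank (suc L) w u S {m} {q} 0≤w 0<m 0<q range Lq≤S 0<S
  with q ≤? count low | argmaxOn low u
  where
  low : Fin _ → Bool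
  low i = S i ∧ ⌊ w i <? 2ℚ * m ⌋
... | yes q≤low | inj₁ none =
      ⊥-elim (<-irrefl (sym (Σ-zero (λ i → cong χ (none i)))) (<-≤-trans 0<q q≤low))
... | yes q≤low | inj₂ (i , lowi , max) = i ,
      heavyRank-max w u _ 0≤w (<⇒≤ 0<m) (<⇒≤ 0<q) m≤w q≤low (upper i lowi) max
  where
  low : Fin _ → Bool
  low i = S i ∧ ⌊ w i <? 2ℚ * m ⌋
  m≤w : ∀ k → low k ≡ true → m ≤ w k
  m≤w k lowk with S k in Sk
  ... | true = proj₁ (range k Sk)
  upper : ∀ k → low k ≡ true → w k ≤ 2ℚ * m
  upper k lowk with S k | w k <? 2ℚ * m
  ... | true | yes p = <⇒≤ p
-- Fewer than `q` members in the lowest class leave more than `L * q` for the other `L` classes,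
-- which start at `2ℚ * m`.
... | no q≰low | _ = heavyRank L w u high 0≤w (*-pos 0<2 0<m) 0<q range′
      Lq≤high (≤-<-trans (*-nonneg (ι-nonneg L) (<⇒≤ 0<q)) Lq<high)
  where
  low high : Fin _ → Bool
  low i = S i ∧ ⌊ w i <? 2ℚ * m ⌋
  high i = S i ∧ not ⌊ w i <? 2ℚ * m ⌋
  range′ : ∀ k → high k ≡ true → 2ℚ * m ≤ w k × w k < 2ℚ ^ L * (2ℚ * m)
  range′ k highk with S k in Sk | w k <? 2ℚ * m
  ... | true | no ¬p = ≮⇒≥ ¬p , subst (w k <_)
        (solve 2 (λ p m → con 2ℚ :* p :* m := p :* (con 2ℚ :* m)) refl (2ℚ ^ L) m) (proj₂ (range k Sk))
  Lq<high : ι L * q < count high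
  Lq<high = +-cancel-< (≰⇒> q≰low) (≤-trans
    (≤-reflexive (trans (solve 2 (λ l q → q :+ l :* q := (con 1ℚ :+ l) :* q) refl (ι L) q)
      (cong (_* q) (sym (ι-suc L)))))
    (≤-trans Lq≤S (≤-reflexive (count-split S (λ i → ⌊ w i <? 2ℚ * m ⌋)))))
    where
    +-cancel-< : ∀ {a b c d} → c < a → a + b ≤ c + d → b < d
    +-cancel-< {a} {b} {c} {d} c<a le with b <? d
    ... | yes b<d = b<d
    ... | no b≮d = ⊥-elim (<-irrefl refl (<-≤-trans (+-mono-<-≤ c<a (≮⇒≥ b≮d)) le))
  Lq≤high = <⇒≤ Lq<high

rankWeight-punchIn : ∀ {n} (w u : Fin (suc n) → ℚ) λ₀ i → (∀ k → 0ℚ ≤ w k) →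
  rankWeight (w ∘ punchIn i) (u ∘ punchIn i) λ₀ ≤ rankWeight w u λ₀
rankWeight-punchIn w u λ₀ i 0≤w = ≤-by (f i) 0≤fi (trans (Σ-punchIn i f) (+-comm (f i) (Σ (f ∘ punchIn i))))
  where
  f : Fin _ → ℚ
  f k = if ⌊ u k ≤? λ₀ ⌋ then w k else 0ℚ
  0≤fi : 0ℚ ≤ f i
  0≤fi with u i ≤? λ₀
  ... | yes _ = 0≤w i
  ... | no _  = ≤-refl

-- Weights may differ by exactly 2ᴸ, so covering them by half-open dyadic classes above the minimum
-- takes `suc L` classes. The pigeonhole threshold is `q = N / suc L`, written `N * b`.
heavyAgent : ∀ L {n} (w u : Fin (suc n) → ℚ) {H} → (∀ i → 0ℚ < w i) →
  (∀ i j → w i ≤ 2ℚ ^ L * w j) → (∀ i → rankWeight w u (u i) ≤ H * u i) →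
  Σ[ i ∈ Fin (suc n) ] (ι (suc n) * w i ≤ 2ℚ * ι (suc L) * H * u i)
heavyAgent L {n} w u {H} 0<w ratio rank = rescale (argmin w) (inverse (ι-pos L))
  where
  N = ι (suc n)
  M = ι (suc L)
  rescale : Σ[ a ∈ Fin (suc n) ] (∀ j → w a ≤ w j) → Σ[ b ∈ ℚ ] (0ℚ < b × M * b ≡ 1ℚ) →
    Σ[ i ∈ Fin (suc n) ] (N * w i ≤ 2ℚ * M * H * u i)
  rescale (a , min) (b , 0<b , Mb≡1) = map₂ bound
    (heavyRank (suc L) w u (λ _ → true) (λ k → <⇒≤ (0<w k)) (0<w a) (*-pos (ι-pos n) 0<b)
        (λ k _ → min k , ≤-<-trans (ratio k a) (<-by (2ℚ ^ L * w a) (*-pos (^-pos 0<2 L) (0<w a))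
          (solve 2 (λ p m → con 2ℚ :* p :* m := p :* m :+ p :* m) refl (2ℚ ^ L) (w a))))
        (≤-reflexive count≡)
        (subst (0ℚ <_) (trans (sym (*-identityʳ N)) (sym (Σ-const (suc n) 1ℚ))) (ι-pos n)))
    where
    count≡ : M * (N * b) ≡ count {suc n} (λ _ → true)
    count≡ = trans (solve 3 (λ K N b → K :* (N :* b) := N :* (K :* b)) refl M N b)
      (trans (cong (N *_) Mb≡1) (sym (Σ-const (suc n) 1ℚ)))
    bound : ∀ {i} → N * b * w i ≤ 2ℚ * rankWeight w u (u i) → N * w i ≤ 2ℚ * M * H * u i
    bound {i} heavy = begin
      N * w i              ≡⟨ cong (_* w i) (trans (sym (*-identityˡ N)) (cong (_* N) (sym Mb≡1))) ⟩
      M * b * N * w i      ≡⟨ solve 4 (λ M b N w → M :* b :* N :* w := M :* (N :* b :* w)) refl M b N (w i) ⟩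
      M * (N * b * w i)    ≤⟨ *-monoˡ (ι-nonneg (suc L)) (≤-trans heavy (*-monoˡ (<⇒≤ 0<2) (rank i))) ⟩
      M * (2ℚ * (H * u i)) ≡⟨ solve 3 (λ M H x → M :* (con 2ℚ :* (H :* x)) := con 2ℚ :* M :* H :* x) refl M H (u i) ⟩
      2ℚ * M * H * u i     ∎
      where open ≤-Reasoning

-- Deleting an agent only lowers rank weights, so the same `H` serves the remaining agents while the
-- count in `heavyAgent` drops by one; these counts multiply to the factorial.
Π-rank-bound : ∀ L n (w u : Fin n → ℚ) {H} → 0ℚ ≤ H → (∀ i → 0ℚ < w i) → (∀ i → 0ℚ ≤ u i) →
  (∀ i j → w i ≤ 2ℚ ^ L * w j) → (∀ i → rankWeight w u (u i) ≤ H * u i) →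
  fact n * Π w ≤ (2ℚ * ι (suc L) * H) ^ n * Π u
Π-rank-bound L zero w u 0≤H 0<w 0≤u ratio rank = ≤-refl
Π-rank-bound L (suc n) w u {H} 0≤H 0<w 0≤u ratio rank = remove (heavyAgent L w u 0<w ratio rank)
  where
  N = ι (suc n)
  K = 2ℚ * ι (suc L) * H
  0≤K : 0ℚ ≤ K
  0≤K = *-nonneg (*-nonneg (<⇒≤ 0<2) (ι-nonneg (suc L))) 0≤H
  remove : Σ[ i ∈ Fin (suc n) ] (N * w i ≤ K * u i) → N * fact n * Π w ≤ K * K ^ n * Π u
  remove (i , heavy) = begin
    N * fact n * Π w        ≡⟨ cong (N * fact n *_) (Π-punchIn i w) ⟩
    N * fact n * (w i * Πw) ≡⟨ solve 4 (λ N f a b → N :* f :* (a :* b) := N :* a :* (f :* b)) refl N (fact n) (w i) Πw ⟩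
    N * w i * (fact n * Πw) ≤⟨ *-mono (*-nonneg (ι-nonneg (suc n)) (<⇒≤ (0<w i)))
                                 (*-nonneg (^-nonneg 0≤K n) (Π-nonneg (0≤u ∘ punchIn i))) heavy ih ⟩
    K * u i * (K ^ n * Πu)  ≡⟨ solve 4 (λ K P a b → K :* a :* (P :* b) := K :* P :* (a :* b)) refl K (K ^ n) (u i) Πu ⟩
    K * K ^ n * (u i * Πu)  ≡⟨ cong (K * K ^ n *_) (sym (Π-punchIn i u)) ⟩
    K * K ^ n * Π u         ∎
    where
    open ≤-Reasoning
    Πw = Π (w ∘ punchIn i)
    Πu = Π (u ∘ punchIn i)
    ih : fact n * Πw ≤ K ^ n * Πu
    ih = Π-rank-bound L n (w ∘ punchIn i) (u ∘ punchIn i) 0≤H (0<w ∘ punchIn i) (0≤u ∘ punchIn i)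
      (λ j k → ratio (punchIn i j) (punchIn i k))
      (λ k → ≤-trans (rankWeight-punchIn w u (u (punchIn i k)) i (λ j → <⇒≤ (0<w j))) (rank (punchIn i k)))

-- Maximizers of a product over one column

Π-cancel₁ : ∀ {n} (f g : Fin n → ℚ) k → (∀ j → j ≢ k → f j ≡ g j) → (∀ j → 0ℚ < g j) →
  Π f ≤ Π g → f k ≤ g k
Π-cancel₁ {suc n} f g k same 0<g Πf≤Πg = *-cancelˡ-≤ (Π-pos (0<g ∘ punchIn k)) (begin
  R * f k            ≡⟨ *-comm R (f k) ⟩
  f k * R            ≡⟨ cong (f k *_) (sym (Π-cong (λ j → same (punchIn k j) (FinP.punchInᵢ≢i k j)))) ⟩
  f k * Π (f ∘ punchIn k) ≡⟨ sym (Π-punchIn k f) ⟩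
  Π f                ≤⟨ Πf≤Πg ⟩
  Π g                ≡⟨ Π-punchIn k g ⟩
  g k * R            ≡⟨ *-comm (g k) R ⟩
  R * g k            ∎)
  where
  open ≤-Reasoning
  R = Π (g ∘ punchIn k)

Π-cancel₂ : ∀ {n} (f g : Fin n → ℚ) i k → i ≢ k → (∀ j → j ≢ i → j ≢ k → f j ≡ g j) →
  (∀ j → 0ℚ < g j) → Π f ≤ Π g → f i * f k ≤ g i * g k
Π-cancel₂ {suc zero} f g fzero fzero i≢k same 0<g Πf≤Πg = ⊥-elim (i≢k refl)
Π-cancel₂ {suc (suc n)} f g i k i≢k same 0<g Πf≤Πg = *-cancelˡ-≤ (Π-pos (0<g ∘ punchIn i ∘ punchIn l)) (begin
  R * (f i * f k)  ≡⟨ cong₂ (λ r x → r * (f i * x)) (sym R≡) (sym (cong f il≡k)) ⟩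
  R′ * (f i * f (punchIn i l)) ≡⟨ solve 3 (λ r a b → r :* (a :* b) := a :* (b :* r)) refl R′ (f i) (f (punchIn i l)) ⟩
  f i * (f (punchIn i l) * R′) ≡⟨ sym (trans (Π-punchIn i f) (cong (f i *_) (Π-punchIn l (f ∘ punchIn i)))) ⟩
  Π f              ≤⟨ Πf≤Πg ⟩
  Π g              ≡⟨ trans (Π-punchIn i g) (cong (g i *_) (Π-punchIn l (g ∘ punchIn i))) ⟩
  g i * (g (punchIn i l) * R) ≡⟨ solve 3 (λ r a b → a :* (b :* r) := r :* (a :* b)) refl R (g i) (g (punchIn i l)) ⟩
  R * (g i * g (punchIn i l)) ≡⟨ cong (λ x → R * (g i * x)) (cong g il≡k) ⟩
  R * (g i * g k)  ∎)
  where
  open ≤-Reasoning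
  l = punchOut i≢k
  il≡k : punchIn i l ≡ k
  il≡k = FinP.punchIn-punchOut i≢k
  R  = Π (g ∘ punchIn i ∘ punchIn l)
  R′ = Π (f ∘ punchIn i ∘ punchIn l)
  R≡ : R′ ≡ R
  R≡ = Π-cong (λ j → same (punchIn i (punchIn l j)) (FinP.punchInᵢ≢i i (punchIn l j))
    (λ eq → FinP.punchInᵢ≢i l j (FinP.punchIn-injective i (punchIn l j) l (trans eq (sym il≡k)))))

-- Provides a transfer so small that the first-order gain `D` beats the second-order loss `W * ε`.
-- The witness is `z * D / (D + z * W)`, which meets both bounds at once.
small-step : ∀ {z D W} → 0ℚ < z → 0ℚ < D → 0ℚ ≤ W → Σ[ ε ∈ ℚ ] (0ℚ < ε × ε ≤ z × W * ε < D)
small-step {z} {D} {W} 0<z 0<D 0≤W = choose (inverse 0<D+zW)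
  where
  0<D+zW : 0ℚ < D + z * W
  0<D+zW = <-≤-trans 0<D (a≤a+r (*-nonneg (<⇒≤ 0<z) 0≤W))
  choose : Σ[ b ∈ ℚ ] (0ℚ < b × (D + z * W) * b ≡ 1ℚ) → Σ[ ε ∈ ℚ ] (0ℚ < ε × ε ≤ z × W * ε < D)
  choose (b , 0<b , inv) = z * (D * b) , *-pos 0<z (*-pos 0<D 0<b) ,
    ≤-by (z * (z * W * b)) (*-nonneg (<⇒≤ 0<z) (*-nonneg (*-nonneg (<⇒≤ 0<z) 0≤W) (<⇒≤ 0<b)))
      (trans (sym (*-identityʳ z)) (trans (cong (z *_) (sym inv))
        (solve 4 (λ z D W b → z :* ((D :+ z :* W) :* b) := z :* (D :* b) :+ z :* (z :* W :* b)) refl z D W b))) ,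
    <-by (D * (D * b)) (*-pos 0<D (*-pos 0<D 0<b))
      (trans (sym (*-identityʳ D)) (trans (cong (D *_) (sym inv))
        (solve 4 (λ z D W b → D :* ((D :+ z :* W) :* b) := W :* (z :* (D :* b)) :+ D :* (D :* b)) refl z D W b)))

-- Serves two purposes: for a greedy step `B` marks the agents whose term enters the objective, and
-- for a column of a Nash welfare maximizer `B` is constantly `true`.
module ColumnOptimum {N} (a w : Fin N → ℚ) (B : Fin N → Bool) (σ : ℚ) (y : Fin N → ℚ)
  (0≤w : ∀ i → 0ℚ ≤ w i) (0≤y : ∀ i → 0ℚ ≤ y i) (Σy≤σ : Σ y ≤ σ)
  (optimal : ∀ z → (∀ i → 0ℚ ≤ z i) × Σ z ≤ σ →
    Π (λ i → if B i then a i + w i * z i else 1ℚ) ≤ Π (λ i → if B i then a i + w i * y i else 1ℚ))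
  (factor-pos : ∀ i → B i ≡ true → 0ℚ < a i + w i * y i) where

  factor : Fin N → ℚ → ℚ
  factor i x = if B i then a i + w i * x else 1ℚ

  final : Fin N → ℚ
  final i = a i + w i * y i

  factor-true : ∀ {i} x → B i ≡ true → factor i x ≡ a i + w i * x
  factor-true {i} x Bi = cong (λ b → if b then a i + w i * x else 1ℚ) Bi

  factor-false : ∀ {i} x → B i ≡ false → factor i x ≡ 1ℚ
  factor-false {i} x Bi = cong (λ b → if b then a i + w i * x else 1ℚ) Bi

  factors-pos : ∀ i → 0ℚ < factor i (y i)
  factors-pos i = by-cases (B i) refl
    where
    by-cases : ∀ b → B i ≡ b → 0ℚ < factor i (y i)
    by-cases true  Bi = subst (0ℚ <_) (sym (factor-true (y i) Bi)) (factor-pos i Bi)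
    by-cases false Bi = subst (0ℚ <_) (sym (factor-false (y i) Bi)) 0<1

  more-is-better : ∀ {k} ε → B k ≡ true → 0ℚ < w k → 0ℚ < ε → factor k (y k) < factor k (y k + ε)
  more-is-better {k} ε Bk 0<wk 0<ε = subst₂ _<_ (sym (factor-true (y k) Bk)) (sym (factor-true (y k + ε) Bk))
    (<-by (w k * ε) (*-pos 0<wk 0<ε)
      (solve 4 (λ a w y e → a :+ w :* (y :+ e) := a :+ w :* y :+ w :* e) refl (a k) (w k) (y k) ε))

  exhausted : ∀ {k} → B k ≡ true → 0ℚ < w k → Σ y ≡ σ
  exhausted {k} Bk 0<wk = by-cases (≤-split Σy≤σ)
    where
    by-cases : Σ y < σ ⊎ Σ y ≡ σ → Σ y ≡ σ
    by-cases (inj₂ eq) = eq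
    by-cases (inj₁ lt) = ⊥-elim (<-irrefl refl (<-≤-trans (more-is-better ε Bk 0<wk 0<ε)
      (subst (λ x → factor k x ≤ factor k (y k)) at-k
        (Π-cancel₁ (λ i → factor i (z i)) (λ i → factor i (y i)) k
          (λ j j≢k → cong (factor j) (off j j≢k)) factors-pos (optimal z (0≤z , ≤-reflexive Σz≡))))))
      where
      ε = σ - Σ y
      0<ε : 0ℚ < ε
      0<ε = <⇒0<- lt
      z : Fin N → ℚ
      z j = y j + δ k j * ε
      at-k : z k ≡ y k + ε
      at-k = cong (y k +_) (trans (cong (_* ε) (δ-refl k)) (*-identityˡ ε))
      off : ∀ j → j ≢ k → z j ≡ y j
      off j j≢k = trans (cong (λ d → y j + d * ε) (δ-≢ (j≢k ∘ sym)))
        (trans (cong (y j +_) (*-zeroˡ ε)) (+-identityʳ (y j)))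
      0≤z : ∀ j → 0ℚ ≤ z j
      0≤z j = +-nonneg (0≤y j) (*-nonneg (δ-nonneg k j) (<⇒≤ 0<ε))
      Σz≡ : Σ z ≡ σ
      Σz≡ = trans (Σ-+ y (λ j → δ k j * ε)) (trans (cong (Σ y +_) (Σ-δ k (λ _ → ε)))
        (solve 2 (λ s t → s :+ (t :- s) := t) refl (Σ y) σ))

  transfer : ∀ {i k ε} → i ≢ k → 0ℚ ≤ ε → ε ≤ y i →
    factor i (y i - ε) * factor k (y k + ε) ≤ factor i (y i) * factor k (y k)
  transfer {i} {k} {ε} i≢k 0≤ε ε≤yi = subst₂ (λ p q → factor i p * factor k q ≤ factor i (y i) * factor k (y k)) at-i at-k
    (Π-cancel₂ (λ j → factor j (z j)) (λ j → factor j (y j)) i k i≢k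
      (λ j j≢i j≢k → cong (factor j) (off j j≢i j≢k)) factors-pos (optimal z (0≤z , ≤-trans (≤-reflexive Σz≡) Σy≤σ)))
    where
    z : Fin N → ℚ
    z j = y j + (δ k j * ε - δ i j * ε)
    z-val : ∀ {j p q} → δ k j ≡ p → δ i j ≡ q → z j ≡ y j + (p * ε - q * ε)
    z-val {j} ep eq = cong₂ (λ p q → y j + (p * ε - q * ε)) ep eq
    at-i : z i ≡ y i - ε
    at-i = trans (z-val (δ-≢ (i≢k ∘ sym)) (δ-refl i))
      (solve 2 (λ y e → y :+ (con 0ℚ :* e :- con 1ℚ :* e) := y :- e) refl (y i) ε)
    at-k : z k ≡ y k + ε
    at-k = trans (z-val (δ-refl k) (δ-≢ i≢k))
      (solve 2 (λ y e → y :+ (con 1ℚ :* e :- con 0ℚ :* e) := y :+ e) refl (y k) ε)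
    off : ∀ j → j ≢ i → j ≢ k → z j ≡ y j
    off j j≢i j≢k = trans (z-val (δ-≢ (j≢k ∘ sym)) (δ-≢ (j≢i ∘ sym)))
      (solve 2 (λ y e → y :+ (con 0ℚ :* e :- con 0ℚ :* e) := y) refl (y j) ε)
    0≤z : ∀ j → 0ℚ ≤ z j
    0≤z j = by-cases (j FinP.≟ i) (j FinP.≟ k)
      where
      by-cases : Dec (j ≡ i) → Dec (j ≡ k) → 0ℚ ≤ z j
      by-cases (yes j≡i) _ = subst (λ j → 0ℚ ≤ z j) (sym j≡i) (subst (0ℚ ≤_) (sym at-i) (≤⇒0≤- ε≤yi))
      by-cases (no _) (yes j≡k) = subst (λ j → 0ℚ ≤ z j) (sym j≡k) (subst (0ℚ ≤_) (sym at-k) (+-nonneg (0≤y k) 0≤ε))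
      by-cases (no j≢i) (no j≢k) = subst (0ℚ ≤_) (sym (off j j≢i j≢k)) (0≤y j)
    Σz≡ : Σ z ≡ Σ y
    Σz≡ = trans (Σ-+ y (λ j → δ k j * ε - δ i j * ε)) (trans (cong (Σ y +_)
      (trans (Σ-- (λ j → δ k j * ε) (λ j → δ i j * ε)) (cong₂ _-_ (Σ-δ k (λ _ → ε)) (Σ-δ i (λ _ → ε)))))
      (solve 2 (λ s e → s :+ (e :- e) := s) refl (Σ y) ε))

  -- An agent outside `B` contributes the factor 1 whatever it gets, so passing its whole share to
  -- `k` would strictly raise the product.
  receives⇒active : ∀ {i k} → B k ≡ true → 0ℚ < w k → 0ℚ < y i → B i ≡ true
  receives⇒active {i} {k} Bk 0<wk 0<yi = by-cases (B i) refl
    where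
    by-cases : ∀ b → B i ≡ b → B i ≡ true
    by-cases true  Bi = Bi
    by-cases false Bi = ⊥-elim (<-irrefl refl (<-≤-trans (more-is-better (y i) Bk 0<wk 0<yi)
      (subst₂ _≤_ (*-identityˡ (factor k (y k + y i))) (*-identityˡ (factor k (y k)))
        (subst₂ (λ p q → p * factor k (y k + y i) ≤ q * factor k (y k))
          (factor-false (y i - y i) Bi) (factor-false (y i) Bi)
          (transfer i≢k (<⇒≤ 0<yi) ≤-refl)))))
      where
      true≢false : ∀ {b} → b ≡ true → b ≡ false → ⊥
      true≢false refl ()
      i≢k : i ≢ k
      i≢k refl = true≢false Bk Bi

  -- The first-order condition `w k / final k ≤ w i / final i` without division. Moving `ε` from `i`
  -- to `k` changes the product of their factors by `ε * (D - w i * w k * ε)`, which is positive for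
  -- small `ε` if the condition fails.
  equilibrium : ∀ {i k} → B k ≡ true → 0ℚ < w k → 0ℚ < y i → w k * final i ≤ w i * final k
  equilibrium {i} {k} Bk 0<wk 0<yi = by-cases (i FinP.≟ k) (w k * final i ≤? w i * final k)
    where
    Bi : B i ≡ true
    Bi = receives⇒active Bk 0<wk 0<yi
    by-cases : Dec (i ≡ k) → Dec (w k * final i ≤ w i * final k) → w k * final i ≤ w i * final k
    by-cases (yes refl) _ = ≤-refl
    by-cases (no _) (yes le) = le
    by-cases (no i≢k) (no ¬le) = ⊥-elim (impossible (small-step 0<yi (<⇒0<- (≰⇒> ¬le)) (*-nonneg (0≤w i) (<⇒≤ 0<wk))))
      where
      D = w k * final i - w i * final k
      impossible : Σ[ ε ∈ ℚ ] (0ℚ < ε × ε ≤ y i × w i * w k * ε < D) → ⊥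
      impossible (ε , 0<ε , ε≤yi , small) = <-irrefl refl (<-≤-trans gain
        (subst₂ _≤_ (cong₂ _*_ (factor-true (y i - ε) Bi) (factor-true (y k + ε) Bk))
          (cong₂ _*_ (factor-true (y i) Bi) (factor-true (y k) Bk)) (transfer i≢k (<⇒≤ 0<ε) ε≤yi)))
        where
        gain : final i * final k < (a i + w i * (y i - ε)) * (a k + w k * (y k + ε))
        gain = <-by (ε * (D - w i * w k * ε)) (*-pos 0<ε (<⇒0<- small))
          (solve 7 (λ ai wi yi ak wk yk e →
              (ai :+ wi :* (yi :- e)) :* (ak :+ wk :* (yk :+ e)) :=
              (ai :+ wi :* yi) :* (ak :+ wk :* yk) :+
                e :* (wk :* (ai :+ wi :* yi) :- wi :* (ak :+ wk :* yk) :- wi :* wk :* e))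
            refl (a i) (w i) (y i) (a k) (w k) (y k) ε)

-- The equal split makes every active factor positive, hence so does the maximizer.
greedy-factor-pos : ∀ {N} {a w : Fin N → ℚ} {σ y} → (∀ i → 0ℚ ≤ a i) → (∀ i → 0ℚ ≤ w i) → 0ℚ < σ →
  IsGreedyStep a w σ y → ∀ i → ⌊ 0ℚ <? a i + w i * σ ⌋ ≡ true → 0ℚ < a i + w i * y i
greedy-factor-pos {suc n} {a} {w} {σ} {y} 0≤a 0≤w 0<σ ((0≤y , Σy≤σ) , optimal) i Bi =
  subst (λ b → 0ℚ < (if b then a i + w i * y i else 1ℚ)) Bi
    (Π>0⇒factor>0 (λ j → if-nonneg (a j + w j * σ) (+-nonneg (0≤a j) (*-nonneg (0≤w j) (0≤y j))))
      (split-positive (inverse (ι-pos n))) i)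
  where
  B : Fin (suc n) → Bool
  B i = ⌊ 0ℚ <? a i + w i * σ ⌋
  if-nonneg : ∀ p {x} → 0ℚ ≤ x → 0ℚ ≤ (if ⌊ 0ℚ <? p ⌋ then x else 1ℚ)
  if-nonneg p 0≤x with 0ℚ <? p
  ... | yes _ = 0≤x
  ... | no _  = 0≤1
  if-pos : ∀ p {x} → (0ℚ < p → 0ℚ < x) → 0ℚ < (if ⌊ 0ℚ <? p ⌋ then x else 1ℚ)
  if-pos p h with 0ℚ <? p
  ... | yes 0<p = h 0<p
  ... | no _    = 0<1
  split-positive : Σ[ b ∈ ℚ ] (0ℚ < b × ι (suc n) * b ≡ 1ℚ) →
    0ℚ < Π (λ i → if B i then a i + w i * y i else 1ℚ)
  split-positive (b , 0<b , inv) = <-≤-trans (Π-pos (λ j → if-pos (a j + w j * σ) (split-pos j)))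
    (optimal (λ _ → σ * b) ((λ _ → *-nonneg (<⇒≤ 0<σ) (<⇒≤ 0<b)) , ≤-reflexive Σ≡))
    where
    Σ≡ : Σ {suc n} (λ _ → σ * b) ≡ σ
    Σ≡ = trans (Σ-const (suc n) (σ * b)) (trans
      (solve 3 (λ k s b → k :* (s :* b) := s :* (k :* b)) refl (ι (suc n)) σ b)
      (trans (cong (σ *_) inv) (*-identityʳ σ)))
    split-pos : ∀ j → 0ℚ < a j + w j * σ → 0ℚ < a j + w j * (σ * b)
    split-pos j h = by-cases (≤-split (0≤a j))
      where
      by-cases : 0ℚ < a j ⊎ 0ℚ ≡ a j → 0ℚ < a j + w j * (σ * b)
      by-cases (inj₁ 0<a) = <-≤-trans 0<a (a≤a+r (*-nonneg (0≤w j) (*-nonneg (<⇒≤ 0<σ) (<⇒≤ 0<b))))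
      by-cases (inj₂ 0≡a) = subst (λ x → 0ℚ < x + w j * (σ * b)) 0≡a
        (subst (0ℚ <_) (trans (*-assoc (w j) σ b) (sym (+-identityˡ (w j * (σ * b)))))
          (*-pos (subst (0ℚ <_) (trans (cong (_+ w j * σ) (sym 0≡a)) (+-identityˡ (w j * σ))) h) 0<b))

-- Support graphs and prices

δ-subst : ∀ {n} (i j : Fin n) (f : Fin n → ℚ) → δ i j * f j ≡ δ i j * f i
δ-subst fzero    fzero    f = refl
δ-subst fzero    (fsuc j) f = trans (*-zeroˡ (f (fsuc j))) (sym (*-zeroˡ (f fzero)))
δ-subst (fsuc i) fzero    f = trans (*-zeroˡ (f fzero)) (sym (*-zeroˡ (f (fsuc i))))
δ-subst (fsuc i) (fsuc j) f = δ-subst i j (f ∘ fsuc)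

if-yes : ∀ {A B : Set} {x y : B} (d : Dec A) → A → (if ⌊ d ⌋ then x else y) ≡ x
if-yes (yes _) _ = refl
if-yes (no ¬a) a = ⊥-elim (¬a a)

if-no : ∀ {A B : Set} {x y : B} (d : Dec A) → ¬ A → (if ⌊ d ⌋ then x else y) ≡ y
if-no (yes a) ¬a = ⊥-elim (¬a a)
if-no (no _) _ = refl

Matrix : ℕ → ℕ → Set
Matrix N T = Fin N → Fin T → ℚ

Edge : ℕ → ℕ → Set
Edge N T = Fin N × Fin T

_≟ₑ_ : ∀ {N T} (e f : Edge N T) → Dec (e ≡ f)
_≟ₑ_ = ≡-dec FinP._≟_ FinP._≟_

module _ {N T : ℕ} where
  open import Data.List.Membership.DecPropositional (_≟ₑ_ {N} {T}) public using (_∈_; _∉_; _∈?_)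

Supported : ∀ {N T} → List (Edge N T) → Matrix N T → Set
Supported S x = ∀ i t → (i , t) ∉ S → x i t ≡ 0ℚ

Balanced : ∀ {N T} → Matrix N T → Set
Balanced d = ∀ t → Σ (λ i → d i t) ≡ 0ℚ

-- The tangent space of the affine space of assignments supported on `S` with prescribed column
-- sums. Signs are unrestricted, so it is closed under all linear combinations.
record Direction {N T} (S : List (Edge N T)) (d : Matrix N T) : Set where
  constructor direction
  field
    supported : Supported S d
    balanced  : Balanced d

infixl 6 _+[_]_

_+[_]_ : ∀ {N T} → Matrix N T → ℚ → Matrix N T → Matrix N T
(x +[ c ] d) i t = x i t + c * d i t

combination : ∀ {N T m} → (Fin m → ℚ) → (Fin m → Matrix N T) → Matrix N T
combination c P i t = Σ (λ l → c l * P l i t)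

module _ {N T : ℕ} {S : List (Edge N T)} where

  +-supported : ∀ {x d : Matrix N T} c → Supported S x → Direction S d → Supported S (x +[ c ] d)
  +-supported c hx (direction hd _) i t ∉S = trans (cong₂ (λ p q → p + c * q) (hx i t ∉S) (hd i t ∉S))
    (solve 1 (λ c → con 0ℚ :+ c :* con 0ℚ := con 0ℚ) refl c)

  column-+ : ∀ {x d : Matrix N T} c → Direction S d → ∀ t → Σ (λ i → (x +[ c ] d) i t) ≡ Σ (λ i → x i t)
  column-+ {x} {d} c (direction _ hd) t = trans (Σ-+ (λ i → x i t) (λ i → c * d i t))
    (trans (cong (Σ (λ i → x i t) +_) (trans (Σ-*ˡ c (λ i → d i t)) (trans (cong (c *_) (hd t)) (*-zeroʳ c))))
      (+-identityʳ (Σ (λ i → x i t))))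

  +-direction : ∀ {x d : Matrix N T} c → Direction S x → Direction S d → Direction S (x +[ c ] d)
  +-direction {x} c (direction sx bx) hd =
    direction (+-supported c sx hd) (λ t → trans (column-+ {x = x} c hd t) (bx t))

  combination-direction : ∀ {m} (c : Fin m → ℚ) {P : Fin m → Matrix N T} →
    (∀ l → Direction S (P l)) → Direction S (combination c P)
  combination-direction c {P} hP = direction
    (λ i t ∉S → Σ-zero (λ l → trans (cong (c l *_) (Direction.supported (hP l) i t ∉S)) (*-zeroʳ (c l))))
    (λ t → trans (Σ-swap (λ i l → c l * P l i t))
      (Σ-zero (λ l → trans (Σ-*ˡ (c l) (λ i → P l i t)) (trans (cong (c l *_) (Direction.balanced (hP l) t)) (*-zeroʳ (c l))))))

  zero-direction : Direction S (λ _ _ → 0ℚ)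
  zero-direction = direction (λ _ _ _ → refl) (λ _ → Σ-0 N)

module _ {N T : ℕ} where

  exchange : Fin N → Fin N → Fin T → Matrix N T
  exchange i k t j t′ = δ t t′ * (δ k j - δ i j)

  exchange-balanced : ∀ i k t → Balanced (exchange i k t)
  exchange-balanced i k t t′ = trans (Σ-*ˡ (δ t t′) (λ j → δ k j - δ i j))
    (trans (cong (δ t t′ *_) (trans (Σ-- (δ k) (δ i)) (cong₂ _-_ (Σδ k) (Σδ i)))) (*-zeroʳ (δ t t′)))
    where
    Σδ : ∀ (k : Fin N) → Σ (δ k) ≡ 1ℚ
    Σδ k = trans (Σ-cong (λ i → sym (*-identityʳ (δ k i)))) (Σ-δ k (λ _ → 1ℚ))

  exchange-direction : ∀ {S : List (Edge N T)} {i k t} → (i , t) ∈ S → (k , t) ∈ S → Direction S (exchange i k t)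
  exchange-direction {S} {i} {k} {t} i∈ k∈ = direction supported (exchange-balanced i k t)
    where
    supported : Supported S (exchange i k t)
    supported j t′ ∉S = by-cases (t FinP.≟ t′)
      where
      by-cases : Dec (t ≡ t′) → exchange i k t j t′ ≡ 0ℚ
      by-cases (no t≢) = trans (cong (_* (δ k j - δ i j)) (δ-≢ t≢)) (*-zeroˡ (δ k j - δ i j))
      by-cases (yes refl) = trans (cong (λ q → δ t t * q) (cong₂ _-_
        (δ-≢ {i = k} {j} λ { refl → ∉S k∈ }) (δ-≢ {i = i} {j} λ { refl → ∉S i∈ }))) (*-zeroʳ (δ t t))

-- Improving directions and price forests

module Directions {N T} (I : Instance N T) where
  open Instance I

  u : Matrix N T → Fin N → ℚ
  u = utility I

  u-+ : ∀ x d c i → u (x +[ c ] d) i ≡ u x i + c * u d i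
  u-+ x d c i = trans (Σ-cong (λ t → solve 4 (λ x c d v → (x :+ c :* d) :* v := x :* v :+ c :* (d :* v))
      refl (x i t) c (d i t) (v i t)))
    (trans (Σ-+ (λ t → x i t * v i t) (λ t → c * (d i t * v i t)))
      (cong (u x i +_) (Σ-*ˡ c (λ t → d i t * v i t))))

  u-combination : ∀ {m} (c : Fin m → ℚ) (P : Fin m → Matrix N T) i →
    u (combination c P) i ≡ Σ (λ l → c l * u (P l) i)
  u-combination c P i = trans (Σ-cong (λ t → sym (Σ-*ʳ (v i t) (λ l → c l * P l i t))))
    (trans (Σ-swap (λ t l → c l * P l i t * v i t))
      (Σ-cong (λ l → trans (Σ-cong (λ t → *-assoc (c l) (P l i t) (v i t))) (Σ-*ˡ (c l) (λ t → P l i t * v i t)))))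

  u-exchange : ∀ i k t m → u (exchange i k t) m ≡ (δ k m - δ i m) * v m t
  u-exchange i k t m = trans (Σ-cong (λ t′ → *-assoc (δ t t′) (δ k m - δ i m) (v m t′)))
    (Σ-δ t (λ t′ → (δ k m - δ i m) * v m t′))

  -- `decrease` guarantees that following `d` eventually meets the boundary of the nonnegative
  -- assignments, where an edge leaves the support; `gain` guarantees that nothing is lost on the
  -- way.
  record Improving (S : List (Edge N T)) : Set where
    field
      d         : Matrix N T
      isDirection : Direction S d
      gain      : ∀ i → 0ℚ ≤ u d i
      decrease  : Σ[ i ∈ Fin N ] Σ[ t ∈ Fin T ] (d i t < 0ℚ)

  -- A direction with no negative entry vanishes, because its columns sum to zero, and then it
  -- changes no utility.
  negative-entry : ∀ {S d} → Direction S d → ∀ {k} → 0ℚ < u d k → Σ[ i ∈ Fin N ] Σ[ t ∈ Fin T ] (d i t < 0ℚ)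
  negative-entry {S} {d} (direction _ bal) {k} 0<u = by-cases (FinP.any? (λ i → FinP.any? (λ t → d i t <? 0ℚ)))
    where
    by-cases : Dec (Σ[ i ∈ Fin N ] Σ[ t ∈ Fin T ] (d i t < 0ℚ)) → Σ[ i ∈ Fin N ] Σ[ t ∈ Fin T ] (d i t < 0ℚ)
    by-cases (yes found) = found
    by-cases (no none) = ⊥-elim (<-irrefl (sym (Σ-zero vanish)) 0<u)
      where
      0≤d : ∀ i t → 0ℚ ≤ d i t
      0≤d i t = ≮⇒≥ (λ lt → none (i , t , lt))
      vanish : ∀ t → d k t * v k t ≡ 0ℚ
      vanish t = trans (cong (_* v k t) (≤-antisym (≤-trans (term≤Σ (λ i → 0≤d i t) k) (≤-reflexive (bal t))) (0≤d k t)))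
        (*-zeroˡ (v k t))

  -- Disposes of the shared items that one of their holders does not value, so that afterwards both
  -- values on a shared item are positive and their ratio makes sense.
  wasteful⇒improving : ∀ {S i k t} → (i , t) ∈ S → (k , t) ∈ S → i ≢ k → v i t ≡ 0ℚ → Improving S
  wasteful⇒improving {S} {i} {k} {t} i∈ k∈ i≢k vit≡0 = record
    { d = exchange i k t
    ; isDirection = exchange-direction i∈ k∈
    ; gain = λ m → subst (0ℚ ≤_) (sym (gain-eq m)) (*-nonneg (δ-nonneg k m) (v-nonneg m t))
    ; decrease = i , t , subst (_< 0ℚ) (sym entry) (negative⁻¹ (- 1ℚ))
    }
    where
    gain-eq : ∀ m → u (exchange i k t) m ≡ δ k m * v m t
    gain-eq m = trans (u-exchange i k t m) (trans
      (solve 3 (λ a b v → (a :- b) :* v := a :* v :- b :* v) refl (δ k m) (δ i m) (v m t))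
      (trans (cong (λ q → δ k m * v m t - q) (trans (δ-subst i m (λ m → v m t)) (trans (cong (δ i m *_) vit≡0) (*-zeroʳ (δ i m)))))
        (+-identityʳ (δ k m * v m t))))
    entry : exchange i k t i t ≡ - 1ℚ
    entry = cong₂ _*_ (δ-refl t) (cong₂ _-_ (δ-≢ (i≢k ∘ sym)) (δ-refl i))

  -- The root of an agent names its component of the support graph processed so far. Inside a component
  -- the ratios of the β are the price ratios forced by first-order optimality, and path l moves one unit
  -- of β-weighted utility from the root of l to l.
  record Forest (S : List (Edge N T)) : Set where
    field
      β         : Fin N → ℚ
      β-pos     : ∀ i → 0ℚ < β i
      root      : Fin N → Fin N
      root-root : ∀ i → root (root i) ≡ root i
      path      : Fin N → Matrix N T
      path-direction : ∀ l → Direction S (path l)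
      value     : ∀ m l → β m * u (path l) m ≡ δ m l - δ m (root l)

    Priced : Fin N → Fin N → Fin T → Set
    Priced i k t = (i , t) ∈ S → (k , t) ∈ S → root i ≡ root k × β i * v i t ≡ β k * v k t

  Extension : ∀ {S} → Forest S → Fin N → Fin N → Fin T → Set
  Extension {S} F i k t = Σ[ F′ ∈ Forest S ] (Forest.Priced F′ i k t × (∀ a b t′ → Forest.Priced F a b t′ → Forest.Priced F′ a b t′))

  trivialForest : ∀ S → Forest S
  trivialForest S = record
    { β = λ _ → 1ℚ ; β-pos = λ _ → 0<1 ; root = λ i → i ; root-root = λ _ → refl
    ; path = λ _ _ _ → 0ℚ ; path-direction = λ _ → zero-direction
    ; value = λ m l → trans (*-identityˡ (u (λ _ _ → 0ℚ) m)) (trans (Σ-zero (λ t → *-zeroˡ (v m t))) (sym (+-inverseʳ (δ m l))))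
    }

  -- A direction whose utility change is concentrated on one agent can be oriented to help that agent.
  concentrated⇒improving : ∀ {S d} k {e} {c : Fin N → ℚ} → Direction S d → (∀ m → 0ℚ < c m) →
    (∀ m → c m * u d m ≡ δ k m * e) → e ≢ 0ℚ → Improving S
  concentrated⇒improving {S} {d} k {e} {c} dir 0<c val e≢0 = by-cases (<-cmp e 0ℚ)
    where
    from : ∀ {d e} → Direction S d → (∀ m → c m * u d m ≡ δ k m * e) → 0ℚ < e → Improving S
    from {d} {e} dir val 0<e = record
      { d = d ; isDirection = dir
      ; gain = λ m → *-cancelˡ-≤ (0<c m) (subst₂ _≤_ (sym (*-zeroʳ (c m))) (sym (val m)) (*-nonneg (δ-nonneg k m) (<⇒≤ 0<e)))
      ; decrease = negative-entry dir {k} (*-cancelˡ-< (<⇒≤ (0<c k)) (subst₂ _<_ (sym (*-zeroʳ (c k)))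
          (sym (trans (val k) (trans (cong (_* e) (δ-refl k)) (*-identityˡ e)))) 0<e))
      }
    zeros : Matrix N T
    zeros _ _ = 0ℚ
    flip : ∀ m → c m * u (zeros +[ - 1ℚ ] d) m ≡ δ k m * - e
    flip m = begin
      c m * u (zeros +[ - 1ℚ ] d) m         ≡⟨ cong (c m *_) (u-+ zeros d (- 1ℚ) m) ⟩
      c m * (u zeros m + (- 1ℚ) * u d m)    ≡⟨ cong (λ q → c m * (q + (- 1ℚ) * u d m)) (Σ-zero (λ t → *-zeroˡ (v m t))) ⟩
      c m * (0ℚ + (- 1ℚ) * u d m)           ≡⟨ solve 2 (λ c u → c :* (con 0ℚ :+ con (- 1ℚ) :* u) := :- (c :* u)) refl (c m) (u d m) ⟩
      - (c m * u d m)                       ≡⟨ cong -_ (val m) ⟩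
      - (δ k m * e)                         ≡⟨ solve 2 (λ x e → :- (x :* e) := x :* :- e) refl (δ k m) e ⟩
      δ k m * - e                           ∎
      where open ≡-Reasoning
    by-cases : Tri (e < 0ℚ) (e ≡ 0ℚ) (0ℚ < e) → Improving S
    by-cases (tri≈ _ e≡0 _) = ⊥-elim (e≢0 e≡0)
    by-cases (tri> _ _ 0<e) = from dir val 0<e
    by-cases (tri< e<0 _ _) = from (+-direction (- 1ℚ) zero-direction dir) flip (neg-antimono-< e<0)

  module Step {S} (F : Forest S) {i k t} (i∈ : (i , t) ∈ S) (k∈ : (k , t) ∈ S)
    (0<vi : 0ℚ < v i t) (0<vk : 0ℚ < v k t) where
    open Forest F

    A B : ℚ
    A = β i * v i t
    B = β k * v k t

    0<A : 0ℚ < A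
    0<A = *-pos (β-pos i) 0<vi
    0<B : 0ℚ < B
    0<B = *-pos (β-pos k) 0<vk

    value-exchange : ∀ m → β m * u (exchange i k t) m ≡ δ k m * B - δ i m * A
    value-exchange m = trans (cong (β m *_) (u-exchange i k t m)) (trans
      (solve 4 (λ b x y v → b :* ((x :- y) :* v) := x :* (b :* v) :- y :* (b :* v)) refl (β m) (δ k m) (δ i m) (v m t))
      (cong₂ _-_ (δ-subst k m (λ m → β m * v m t)) (δ-subst i m (λ m → β m * v m t))))

    -- Going around the cycle: the exchange costs `i` the amount `A` and brings `k` the amount `B`,
    -- `A` times `path i` refunds `i` from the common root, and `- A` times `path k` returns `A`
    -- from `k` to that root. Only `B - A` at `k` survives.
    close-cycle : root i ≡ root k → A ≢ B → Improving S
    close-cycle ri≡rk A≢B = concentrated⇒improving k {c = β}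
      (+-direction (- A) (+-direction A (exchange-direction i∈ k∈) (path-direction i)) (path-direction k))
      β-pos cycle-value B-A≢0
      where
      X = exchange i k t
      cycle-value : ∀ m → β m * u (X +[ A ] path i +[ - A ] path k) m ≡ δ k m * (B - A)
      cycle-value m = begin
        β m * u (X +[ A ] path i +[ - A ] path k) m
          ≡⟨ cong (β m *_) (trans (u-+ (X +[ A ] path i) (path k) (- A) m) (cong (_+ (- A) * u (path k) m) (u-+ X (path i) A m))) ⟩
        β m * (u X m + A * u (path i) m + (- A) * u (path k) m)
          ≡⟨ solve 5 (λ b x y z a → b :* (x :+ a :* y :+ (:- a) :* z) := b :* x :+ a :* (b :* y) :- a :* (b :* z)) refl
               (β m) (u X m) (u (path i) m) (u (path k) m) A ⟩
        β m * u X m + A * (β m * u (path i) m) - A * (β m * u (path k) m)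
          ≡⟨ cong₂ (λ p q → p - A * q) (cong₂ (λ p q → p + A * q) (value-exchange m) (value m i)) (value m k) ⟩
        δ k m * B - δ i m * A + A * (δ m i - δ m (root i)) - A * (δ m k - δ m (root k))
          ≡⟨ cong₂ (λ p q → δ k m * B - δ i m * A + A * (p - δ m (root i)) - A * (q - δ m (root k))) (δ-sym m i) (δ-sym m k) ⟩
        δ k m * B - δ i m * A + A * (δ i m - δ m (root i)) - A * (δ k m - δ m (root k))
          ≡⟨ cong (λ r → δ k m * B - δ i m * A + A * (δ i m - δ m r) - A * (δ k m - δ m (root k))) ri≡rk ⟩
        δ k m * B - δ i m * A + A * (δ i m - δ m (root k)) - A * (δ k m - δ m (root k))
          ≡⟨ solve 5 (λ x y r a b → x :* b :- y :* a :+ a :* (y :- r) :- a :* (x :- r) := x :* (b :- a)) refl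
               (δ k m) (δ i m) (δ m (root k)) A B ⟩
        δ k m * (B - A) ∎
        where open ≡-Reasoning
      B-A≢0 : B - A ≢ 0ℚ
      B-A≢0 eq = A≢B (trans (solve 2 (λ a b → a := b :- (b :- a)) refl A B) (trans (cong (λ q → B - q) eq) (+-identityʳ B)))

    module Merge (ri≢rk : root i ≢ root k) (A⁻ B⁻ : ℚ) (0<A⁻ : 0ℚ < A⁻) (0<B⁻ : 0ℚ < B⁻)
      (AA⁻≡1 : A * A⁻ ≡ 1ℚ) (BB⁻≡1 : B * B⁻ ≡ 1ℚ) where

      -- The rescaling of `β` on the component of `k` that makes both sides of the new edge agree:
      -- `ratio * B` is `A`. The component of `i` keeps its `β`.
      ratio : ℚ
      ratio = A * B⁻

      ratio⁻ : ℚ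
      ratio⁻ = B * A⁻

      inK : ∀ l → Dec (l ≡ root k)
      inK l = l FinP.≟ root k

      newRoot : Fin N → Fin N
      newRoot r = if ⌊ inK r ⌋ then root i else r

      scale : Fin N → ℚ
      scale r = if ⌊ inK r ⌋ then ratio else 1ℚ

      -- The route from `root i` to `l`: along `path i`, across the exchange, back along `path k` to
      -- the old root, then along `path l`. The exchange turns one unit leaving `i` into `ratio⁻`
      -- old units at `k`, and these are one unit again after the rescaling.
      joined : Fin N → Matrix N T
      joined l = path i +[ A⁻ ] exchange i k t +[ - ratio⁻ ] path k +[ ratio⁻ ] path l

      newPath : Fin N → Matrix N T
      newPath l = if ⌊ inK (root l) ⌋ then joined l else path l

      ratio*B : ratio * B ≡ A
      ratio*B = trans (solve 3 (λ a b c → a :* c :* b := a :* (b :* c)) refl A B B⁻)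
        (trans (cong (A *_) BB⁻≡1) (*-identityʳ A))

      ratio*ratio⁻ : ratio * ratio⁻ ≡ 1ℚ
      ratio*ratio⁻ = trans (solve 4 (λ a b c d → a :* d :* (b :* c) := a :* c :* (b :* d)) refl A B A⁻ B⁻)
        (cong₂ _*_ AA⁻≡1 BB⁻≡1)

      joined-value : ∀ m l → β m * u (joined l) m ≡
        δ m i - δ m (root i) + A⁻ * (δ k m * B - δ i m * A) + (- ratio⁻) * (δ m k - δ m (root k)) + ratio⁻ * (δ m l - δ m (root l))
      joined-value m l = begin
        β m * u (joined l) m
          ≡⟨ cong (β m *_) (trans (u-+ (path i +[ A⁻ ] X +[ - ratio⁻ ] path k) (path l) ratio⁻ m)
               (cong (_+ ratio⁻ * u (path l) m) (trans (u-+ (path i +[ A⁻ ] X) (path k) (- ratio⁻) m)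
                 (cong (_+ (- ratio⁻) * u (path k) m) (u-+ (path i) X A⁻ m))))) ⟩
        β m * (u (path i) m + A⁻ * u X m + (- ratio⁻) * u (path k) m + ratio⁻ * u (path l) m)
          ≡⟨ solve 8 (λ b p x q r a c d → b :* (p :+ a :* x :+ c :* q :+ d :* r) :=
                 b :* p :+ a :* (b :* x) :+ c :* (b :* q) :+ d :* (b :* r)) refl
               (β m) (u (path i) m) (u X m) (u (path k) m) (u (path l) m) A⁻ (- ratio⁻) ratio⁻ ⟩
        β m * u (path i) m + A⁻ * (β m * u X m) + (- ratio⁻) * (β m * u (path k) m) + ratio⁻ * (β m * u (path l) m)
          ≡⟨ cong₂ _+_ (cong₂ (λ p q → p + (- ratio⁻) * q) (cong₂ (λ p q → p + A⁻ * q) (value m i) (value-exchange m)) (value m k))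
               (cong (ratio⁻ *_) (value m l)) ⟩
        δ m i - δ m (root i) + A⁻ * (δ k m * B - δ i m * A) + (- ratio⁻) * (δ m k - δ m (root k)) + ratio⁻ * (δ m l - δ m (root l)) ∎
        where
        open ≡-Reasoning
        X = exchange i k t

      distinct : ∀ {a b} → root a ≡ root k → root b ≢ root k → δ a b ≡ 0ℚ
      distinct {a} {b} a∈ b∉ = δ-≢ {i = a} {b} (λ { refl → b∉ a∈ })

      distinct′ : ∀ {a b} → root a ≢ root k → root b ≡ root k → δ a b ≡ 0ℚ
      distinct′ {a} {b} a∉ b∈ = δ-≢ {i = a} {b} (λ { refl → a∉ b∈ })

      joined-value-in : ∀ m l → root l ≡ root k → root m ≡ root k →
        ratio * β m * u (joined l) m ≡ δ m l - δ m (root i)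
      joined-value-in m l l∈ m∈ = begin
        ratio * β m * u (joined l) m
          ≡⟨ trans (*-assoc ratio (β m) (u (joined l) m)) (cong (ratio *_) (joined-value m l)) ⟩
        ratio * (δ m i - δ m (root i) + A⁻ * (δ k m * B - δ i m * A) + (- ratio⁻) * (δ m k - δ m (root k)) + ratio⁻ * (δ m l - δ m (root l)))
          ≡⟨ cong₂ (λ p q → ratio * (p + (- ratio⁻) * (δ m k - δ m (root k)) + ratio⁻ * (δ m l - q)))
               (cong₂ (λ p q → p + A⁻ * q)
                 (cong₂ _-_ (distinct m∈ ri≢rk) δm-ri)
                 (cong₂ (λ p q → p * B - q * A) (δ-sym k m) (distinct′ ri≢rk m∈)))
               (cong (δ m) l∈) ⟩
        ratio * (0ℚ - 0ℚ + A⁻ * (δ m k * B - 0ℚ * A) + (- ratio⁻) * (δ m k - δ m (root k)) + ratio⁻ * (δ m l - δ m (root k)))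
          ≡⟨ solve 7 (λ r p x y a b c → r :* (con 0ℚ :- con 0ℚ :+ c :* (p :* b :- con 0ℚ :* a) :+ (:- (b :* c)) :* (p :- y) :+ b :* c :* (x :- y))
                 := r :* (b :* c) :* x) refl ratio (δ m k) (δ m l) (δ m (root k)) A B A⁻ ⟩
        ratio * ratio⁻ * δ m l
          ≡⟨ trans (cong (_* δ m l) ratio*ratio⁻) (*-identityˡ (δ m l)) ⟩
        δ m l
          ≡⟨ sym (trans (cong (λ q → δ m l - q) δm-ri) (+-identityʳ (δ m l))) ⟩
        δ m l - δ m (root i) ∎
        where
        open ≡-Reasoning
        δm-ri : δ m (root i) ≡ 0ℚ
        δm-ri = distinct m∈ (λ eq → ri≢rk (trans (sym (root-root i)) eq))

      joined-value-out : ∀ m l → root l ≡ root k → root m ≢ root k →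
        1ℚ * β m * u (joined l) m ≡ δ m l - δ m (root i)
      joined-value-out m l l∈ m∉ = begin
        1ℚ * β m * u (joined l) m
          ≡⟨ trans (cong (_* u (joined l) m) (*-identityˡ (β m))) (joined-value m l) ⟩
        δ m i - δ m (root i) + A⁻ * (δ k m * B - δ i m * A) + (- ratio⁻) * (δ m k - δ m (root k)) + ratio⁻ * (δ m l - δ m (root l))
          ≡⟨ cong₂ _+_ (cong₂ (λ p q → p + (- ratio⁻) * q)
                 (cong₂ (λ p q → δ m i - δ m (root i) + A⁻ * (p * B - q * A)) (distinct refl m∉) (δ-sym i m))
                 (cong₂ _-_ (distinct′ m∉ refl) δm-rk))
               (cong (ratio⁻ *_) (cong₂ _-_ δm-l (trans (cong (δ m) l∈) δm-rk))) ⟩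
        δ m i - δ m (root i) + A⁻ * (0ℚ * B - δ m i * A) + (- ratio⁻) * (0ℚ - 0ℚ) + ratio⁻ * (0ℚ - 0ℚ)
          ≡⟨ solve 6 (λ x y a b c r → x :- y :+ c :* (con 0ℚ :* b :- x :* a) :+ (:- r) :* (con 0ℚ :- con 0ℚ) :+ r :* (con 0ℚ :- con 0ℚ)
                 := x :- y :- (a :* c) :* x) refl (δ m i) (δ m (root i)) A B A⁻ ratio⁻ ⟩
        δ m i - δ m (root i) - A * A⁻ * δ m i
          ≡⟨ cong (λ q → δ m i - δ m (root i) - q * δ m i) AA⁻≡1 ⟩
        δ m i - δ m (root i) - 1ℚ * δ m i
          ≡⟨ solve 2 (λ x y → x :- y :- con 1ℚ :* x := con 0ℚ :- y) refl (δ m i) (δ m (root i)) ⟩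
        0ℚ - δ m (root i)
          ≡⟨ cong (_- δ m (root i)) (sym δm-l) ⟩
        δ m l - δ m (root i) ∎
        where
        open ≡-Reasoning
        δm-rk : δ m (root k) ≡ 0ℚ
        δm-rk = distinct′ m∉ (root-root k)
        δm-l : δ m l ≡ 0ℚ
        δm-l = distinct′ m∉ l∈

      path-value : ∀ m l → root l ≢ root k → scale (root m) * β m * u (path l) m ≡ δ m l - δ m (root l)
      path-value m l l∉ = by-cases (inK (root m))
        where
        by-cases : Dec (root m ≡ root k) → scale (root m) * β m * u (path l) m ≡ δ m l - δ m (root l)
        by-cases (no m∉) = trans (cong (λ q → q * β m * u (path l) m) (if-no (inK (root m)) m∉))
          (trans (cong (_* u (path l) m) (*-identityˡ (β m))) (value m l))
        by-cases (yes m∈) = trans (*-assoc (scale (root m)) (β m) (u (path l) m))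
          (trans (cong (scale (root m) *_) (trans (value m l) zero-diff))
            (trans (*-zeroʳ (scale (root m))) (sym zero-diff)))
          where
          zero-diff : δ m l - δ m (root l) ≡ 0ℚ - 0ℚ
          zero-diff = cong₂ _-_ (distinct m∈ l∉) (distinct m∈ (λ eq → l∉ (trans (sym (root-root l)) eq)))

      newValue : ∀ m l → scale (root m) * β m * u (newPath l) m ≡ δ m l - δ m (newRoot (root l))
      newValue m l = by-cases (inK (root l)) (inK (root m))
        where
        in-K : root l ≡ root k → scale (root m) * β m * u (joined l) m ≡ δ m l - δ m (root i) →
          scale (root m) * β m * u (newPath l) m ≡ δ m l - δ m (newRoot (root l))
        in-K l∈ h = trans (cong (λ p → scale (root m) * β m * u p m) (if-yes (inK (root l)) l∈))
          (trans h (cong (λ r → δ m l - δ m r) (sym (if-yes (inK (root l)) l∈))))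
        by-cases : Dec (root l ≡ root k) → Dec (root m ≡ root k) →
          scale (root m) * β m * u (newPath l) m ≡ δ m l - δ m (newRoot (root l))
        by-cases (yes l∈) (yes m∈) = in-K l∈ (trans (cong (λ q → q * β m * u (joined l) m) (if-yes (inK (root m)) m∈))
          (joined-value-in m l l∈ m∈))
        by-cases (yes l∈) (no m∉) = in-K l∈ (trans (cong (λ q → q * β m * u (joined l) m) (if-no (inK (root m)) m∉))
          (joined-value-out m l l∈ m∉))
        by-cases (no l∉) _ = trans (cong (λ p → scale (root m) * β m * u p m) (if-no (inK (root l)) l∉))
          (trans (path-value m l l∉) (cong (λ r → δ m l - δ m r) (sym (if-no (inK (root l)) l∉))))

      newRoot-ri : newRoot (root i) ≡ root i
      newRoot-ri = if-no (inK (root i)) ri≢rk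

      mergedForest : Forest S
      mergedForest = record
        { β = λ m → scale (root m) * β m
        ; β-pos = λ m → *-pos (scale-pos (root m)) (β-pos m)
        ; root = newRoot ∘ root
        ; root-root = idempotent
        ; path = newPath
        ; path-direction = newPath-direction
        ; value = newValue
        }
        where
        scale-pos : ∀ r → 0ℚ < scale r
        scale-pos r with inK r
        ... | yes _ = *-pos 0<A 0<B⁻
        ... | no _  = 0<1
        idempotent : ∀ l → newRoot (root (newRoot (root l))) ≡ newRoot (root l)
        idempotent l = by-cases (inK (root l))
          where
          by-cases : Dec (root l ≡ root k) → newRoot (root (newRoot (root l))) ≡ newRoot (root l)
          by-cases (yes l∈) = trans (cong (newRoot ∘ root) nr) (trans (cong newRoot (root-root i)) (trans newRoot-ri (sym nr)))
            where
            nr : newRoot (root l) ≡ root i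
            nr = if-yes (inK (root l)) l∈
          by-cases (no l∉) = trans (cong (newRoot ∘ root) (if-no (inK (root l)) l∉)) (cong newRoot (root-root l))
        newPath-direction : ∀ l → Direction S (newPath l)
        newPath-direction l with inK (root l)
        ... | yes _ = +-direction ratio⁻ (+-direction (- ratio⁻) (+-direction A⁻ (path-direction i)
              (exchange-direction i∈ k∈)) (path-direction k)) (path-direction l)
        ... | no _  = path-direction l

      newlyPriced : Forest.Priced mergedForest i k t
      newlyPriced _ _ = trans newRoot-ri (sym (if-yes (inK (root k)) refl)) ,
        trans (cong (λ q → q * β i * v i t) (if-no (inK (root i)) ri≢rk))
          (trans (cong (_* v i t) (*-identityˡ (β i)))
            (trans (sym ratio*B) (trans (sym (*-assoc ratio (β k) (v k t)))
              (cong (λ q → q * β k * v k t) (sym (if-yes (inK (root k)) refl))))))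

      -- Agents already tied by a price share a root, so both are rescaled by the same factor.
      stillPriced : ∀ a b t′ → Priced a b t′ → Forest.Priced mergedForest a b t′
      stillPriced a b t′ h a∈ b∈ = transport (h a∈ b∈)
        where
        transport : root a ≡ root b × β a * v a t′ ≡ β b * v b t′ →
          newRoot (root a) ≡ newRoot (root b) × scale (root a) * β a * v a t′ ≡ scale (root b) * β b * v b t′
        transport (ra≡rb , eq) = cong newRoot ra≡rb ,
          trans (*-assoc (scale (root a)) (β a) (v a t′))
            (trans (cong₂ _*_ (cong scale ra≡rb) eq) (sym (*-assoc (scale (root b)) (β b) (v b t′))))

    merge : root i ≢ root k → Extension F i k t
    merge ri≢rk = from (inverse 0<A) (inverse 0<B)
      where
      from : Σ[ A⁻ ∈ ℚ ] (0ℚ < A⁻ × A * A⁻ ≡ 1ℚ) → Σ[ B⁻ ∈ ℚ ] (0ℚ < B⁻ × B * B⁻ ≡ 1ℚ) → Extension F i k t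
      from (A⁻ , 0<A⁻ , AA⁻) (B⁻ , 0<B⁻ , BB⁻) = mergedForest , newlyPriced , stillPriced
        where open Merge ri≢rk A⁻ B⁻ 0<A⁻ 0<B⁻ AA⁻ BB⁻

    extend : Improving S ⊎ Extension F i k t
    extend = by-cases (root i FinP.≟ root k) (A ≟ B)
      where
      by-cases : Dec (root i ≡ root k) → Dec (A ≡ B) → Improving S ⊎ Extension F i k t
      by-cases (no ri≢rk) _         = inj₂ (merge ri≢rk)
      by-cases (yes ri≡rk) (no A≢B) = inj₁ (close-cycle ri≡rk A≢B)
      by-cases (yes ri≡rk) (yes A≡B) = inj₂ (F , (λ _ _ → ri≡rk , A≡B) , λ _ _ _ h → h)

  addPrice : ∀ {S} (F : Forest S) i k t →
    Improving S ⊎ Extension F i k t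
  addPrice {S} F i k t = by-cases ((i , t) ∈? S) ((k , t) ∈? S) (i FinP.≟ k) (≤-split (v-nonneg i t)) (≤-split (v-nonneg k t))
    where
    unchanged : Forest.Priced F i k t → Improving S ⊎ Extension F i k t
    unchanged p = inj₂ (F , p , λ _ _ _ h → h)
    by-cases : Dec ((i , t) ∈ S) → Dec ((k , t) ∈ S) → Dec (i ≡ k) → 0ℚ < v i t ⊎ 0ℚ ≡ v i t → 0ℚ < v k t ⊎ 0ℚ ≡ v k t →
      Improving S ⊎ Extension F i k t
    by-cases (no i∉) _ _ _ _ = unchanged (λ i∈ _ → ⊥-elim (i∉ i∈))
    by-cases (yes _) (no k∉) _ _ _ = unchanged (λ _ k∈ → ⊥-elim (k∉ k∈))
    by-cases (yes _) (yes _) (yes refl) _ _ = unchanged (λ _ _ → refl , refl)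
    by-cases (yes i∈) (yes k∈) (no i≢k) (inj₂ 0≡vi) _ = inj₁ (wasteful⇒improving i∈ k∈ i≢k (sym 0≡vi))
    by-cases (yes i∈) (yes k∈) (no i≢k) (inj₁ _) (inj₂ 0≡vk) = inj₁ (wasteful⇒improving k∈ i∈ (i≢k ∘ sym) (sym 0≡vk))
    by-cases (yes i∈) (yes k∈) (no i≢k) (inj₁ 0<vi) (inj₁ 0<vk) = Step.extend F i∈ k∈ 0<vi 0<vk

  priceAll : ∀ S (τs : List (Fin N × Fin N × Fin T)) →
    Improving S ⊎ (Σ[ F ∈ Forest S ] All (λ { (i , k , t) → Forest.Priced F i k t }) τs)
  priceAll S [] = inj₂ (trivialForest S , [])
  priceAll S ((i , k , t) ∷ τs) = Sum.[ inj₁ , (λ { (F , priced) → Sum.map₂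
      (λ { (F′ , new , still) → F′ , new ∷ All.map (λ {τ} → still (proj₁ τ) (proj₁ (proj₂ τ)) (proj₂ (proj₂ τ))) priced })
      (addPrice F i k t) }) ]′ (priceAll S τs)

  improving⊎forest : ∀ S → Improving S ⊎ (Σ[ F ∈ Forest S ] (∀ i k t → Forest.Priced F i k t))
  improving⊎forest S = Sum.map₂ (λ { (F , priced) → F , λ i k t → All.lookup priced
      (∈-cartesianProduct⁺ (∈-allFin i) (∈-cartesianProduct⁺ (∈-allFin k) (∈-allFin t))) })
    (priceAll S (cartesianProduct (allFin N) (cartesianProduct (allFin N) (allFin T))))

-- Existence of a rational maximizer

-- The mean of `m` with weights `f`. All weights vanish for an index that is nobody's root; any
-- positive number then satisfies the equation, and 1 is chosen.
common-mean : ∀ {n} (f m : Fin n → ℚ) → (∀ i → 0ℚ ≤ f i) → (∀ i → 0ℚ < m i) →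
  Σ[ a ∈ ℚ ] (0ℚ < a × Σ f * a ≡ Σ (λ i → f i * m i))
common-mean {zero}  f m 0≤f 0<m = 1ℚ , 0<1 , refl
common-mean {suc n} f m 0≤f 0<m = by-cases (≤-split (Σ-nonneg 0≤f))
  where
  Mean : Set
  Mean = Σ[ a ∈ ℚ ] (0ℚ < a × Σ f * a ≡ Σ (λ i → f i * m i))
  divide : 0ℚ < Σ (λ i → f i * m i) → Σ[ b ∈ ℚ ] (0ℚ < b × Σ f * b ≡ 1ℚ) → Mean
  divide 0<fm (b , 0<b , inv) = Σ (λ i → f i * m i) * b , *-pos 0<fm 0<b ,
    trans (solve 3 (λ s p b → s :* (p :* b) := p :* (s :* b)) refl (Σ f) (Σ (λ i → f i * m i)) b)
      (trans (cong (Σ (λ i → f i * m i) *_) inv) (*-identityʳ _))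
  by-cases : 0ℚ < Σ f ⊎ 0ℚ ≡ Σ f → Mean
  by-cases (inj₁ 0<Σf) = divide (positive-sum (argmin m)) (inverse 0<Σf)
    where
    positive-sum : Σ[ l ∈ Fin (suc n) ] (∀ j → m l ≤ m j) → 0ℚ < Σ (λ i → f i * m i)
    positive-sum (l , min) = <-≤-trans (*-pos 0<Σf (0<m l))
      (≤-trans (≤-reflexive (sym (Σ-*ʳ (m l) f))) (Σ-mono (λ i → *-monoˡ (0≤f i) (min i))))
  by-cases (inj₂ 0≡Σf) = 1ℚ , 0<1 , trans (*-identityʳ (Σ f)) (trans (sym 0≡Σf)
    (sym (Σ-zero (λ i → trans (cong (_* m i) (≤-antisym (≤-trans (term≤Σ 0≤f i) (≤-reflexive (sym 0≡Σf))) (0≤f i))) (*-zeroˡ (m i))))))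

-- The ratio test of the simplex method: the longest step that keeps every listed entry nonnegative,
-- with an entry that blocks any longer one.
boundary-step : ∀ {A : Set} (p q : A → ℚ) → (∀ x → 0ℚ ≤ p x) → (xs : List A) →
  All (λ x → 0ℚ ≤ q x) xs ⊎
  (Σ[ τ ∈ ℚ ] (0ℚ ≤ τ × All (λ x → 0ℚ ≤ p x + τ * q x) xs × Σ[ x ∈ A ] (q x < 0ℚ × p x + τ * q x ≡ 0ℚ)))
boundary-step p q 0≤p [] = inj₁ []
boundary-step {A} p q 0≤p (x ∷ xs) = by-cases (boundary-step p q 0≤p xs) (q x <? 0ℚ)
  where
  Blocked : List A → Set
  Blocked xs = Σ[ τ ∈ ℚ ] (0ℚ ≤ τ × All (λ x → 0ℚ ≤ p x + τ * q x) xs × Σ[ x ∈ A ] (q x < 0ℚ × p x + τ * q x ≡ 0ℚ))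

  stop-at-x : q x < 0ℚ → (∀ τ → 0ℚ ≤ τ → p x + τ * q x ≡ 0ℚ → All (λ z → 0ℚ ≤ p z + τ * q z) xs) → Blocked (x ∷ xs)
  stop-at-x qx<0 rest = from (inverse (neg-antimono-< qx<0))
    where
    from : Σ[ b ∈ ℚ ] (0ℚ < b × - q x * b ≡ 1ℚ) → Blocked (x ∷ xs)
    from (b , 0<b , inv) = p x * b , 0≤τ , ≤-reflexive (sym at-x) ∷ rest (p x * b) 0≤τ at-x , x , qx<0 , at-x
      where
      0≤τ : 0ℚ ≤ p x * b
      0≤τ = *-nonneg (0≤p x) (<⇒≤ 0<b)
      at-x : p x + p x * b * q x ≡ 0ℚ
      at-x = trans (solve 3 (λ p b q → p :+ p :* b :* q := p :* (con 1ℚ :- :- q :* b)) refl (p x) b (q x))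
        (trans (cong (λ r → p x * (1ℚ - r)) inv) (*-zeroʳ (p x)))

  nonneg-keeps : ∀ {τ z} → 0ℚ ≤ τ → 0ℚ ≤ q z → 0ℚ ≤ p z + τ * q z
  nonneg-keeps {z = z} 0≤τ 0≤q = +-nonneg (0≤p z) (*-nonneg 0≤τ 0≤q)

  -- At `τ` the new entry is already negative while at `τ′` it is zero. As it decreases, `τ′` is the
  -- shorter step, and shortening preserves nonnegativity of the other entries.
  shrink : ∀ {τ} → 0ℚ ≤ τ → q x < 0ℚ → p x + τ * q x < 0ℚ → ∀ τ′ → 0ℚ ≤ τ′ → p x + τ′ * q x ≡ 0ℚ →
    ∀ {z} → 0ℚ ≤ p z + τ * q z → 0ℚ ≤ p z + τ′ * q z
  shrink {τ} 0≤τ qx<0 beyond τ′ 0≤τ′ at-x {z} h = by-sign (≤-total 0ℚ (q z))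
    where
    τ′≤τ : τ′ ≤ τ
    τ′≤τ = *-cancelˡ-≤ (neg-antimono-< qx<0) (≤-by (- (p x + τ * q x)) (<⇒≤ (neg-antimono-< beyond))
      (trans (solve 4 (λ p q s t → :- q :* t := :- q :* s :+ :- (p :+ t :* q) :+ (p :+ s :* q)) refl (p x) (q x) τ′ τ)
        (trans (cong (- q x * τ′ + - (p x + τ * q x) +_) at-x) (+-identityʳ _))))
    by-sign : 0ℚ ≤ q z ⊎ q z ≤ 0ℚ → 0ℚ ≤ p z + τ′ * q z
    by-sign (inj₁ 0≤q) = nonneg-keeps {z = z} 0≤τ′ 0≤q
    by-sign (inj₂ q≤0) = ≤-trans h (≤-by ((τ - τ′) * - q z)
      (*-nonneg (≤⇒0≤- τ′≤τ) (neg-antimono-≤ q≤0))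
      (solve 4 (λ p q s t → p :+ s :* q := p :+ t :* q :+ (t :- s) :* :- q) refl (p z) (q z) τ′ τ))

  by-cases : All (λ x → 0ℚ ≤ q x) xs ⊎ Blocked xs → Dec (q x < 0ℚ) → All (λ x → 0ℚ ≤ q x) (x ∷ xs) ⊎ Blocked (x ∷ xs)
  by-cases (inj₁ 0≤q) (no qx≮0) = inj₁ (≮⇒≥ qx≮0 ∷ 0≤q)
  by-cases (inj₁ 0≤q) (yes qx<0) = inj₂ (stop-at-x qx<0 (λ τ 0≤τ _ → All.map (λ {z} → nonneg-keeps {z = z} 0≤τ) 0≤q))
  by-cases (inj₂ (τ , 0≤τ , all , z , qz<0 , at-z)) (no qx≮0) =
    inj₂ (τ , 0≤τ , nonneg-keeps {z = x} 0≤τ (≮⇒≥ qx≮0) ∷ all , z , qz<0 , at-z)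
  by-cases (inj₂ (τ , 0≤τ , all , z , qz<0 , at-z)) (yes qx<0) = by-reach (p x + τ * q x <? 0ℚ)
    where
    by-reach : Dec (p x + τ * q x < 0ℚ) → All (λ x → 0ℚ ≤ q x) (x ∷ xs) ⊎ Blocked (x ∷ xs)
    by-reach (no ≮0) = inj₂ (τ , 0≤τ , ≮⇒≥ ≮0 ∷ all , z , qz<0 , at-z)
    by-reach (yes <0) = inj₂ (stop-at-x qx<0 (λ τ′ 0≤τ′ at-x → All.map (shrink 0≤τ qx<0 <0 τ′ 0≤τ′ at-x) all))

module Existence {N T} (I : Instance N T) where
  open Instance I
  open Directions I

  -- x is stationary for log Nash welfare on the affine space of full assignments supported on S.
  record Critical (S : List (Edge N T)) (x : Matrix N T) : Set where
    field
      γ      : Fin N → ℚ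
      γ-pos  : ∀ i → 0ℚ < γ i
      unit   : ∀ i → γ i * u x i ≡ 1ℚ
      priced : ∀ i k t → (i , t) ∈ S → (k , t) ∈ S → γ i * v i t ≡ γ k * v k t

    -- On the edges of an item, `γ i * v i t` is one common price. The weighted total is therefore
    -- price times column sum, and the columns of a direction sum to zero.
    conserved : ∀ {d} → Direction S d → Σ (λ i → γ i * u d i) ≡ 0ℚ
    conserved {d} (direction supp bal) = trans (Σ-cong (λ i → sym (Σ-*ˡ (γ i) (λ t → d i t * v i t))))
      (trans (Σ-swap (λ i t → γ i * (d i t * v i t))) (Σ-zero (λ t → at t (FinP.any? (λ k → (k , t) ∈? S)))))
      where
      at : ∀ t → Dec (∃ λ k → (k , t) ∈ S) → Σ (λ i → γ i * (d i t * v i t)) ≡ 0ℚ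
      at t (no none) = Σ-zero (λ i → trans (cong (λ q → γ i * (q * v i t)) (supp i t (λ i∈ → none (i , i∈))))
        (solve 2 (λ g v → g :* (con 0ℚ :* v) := con 0ℚ) refl (γ i) (v i t)))
      at t (yes (k , k∈)) = trans (Σ-cong (λ i → term i ((i , t) ∈? S)))
        (trans (Σ-*ʳ (γ k * v k t) (λ i → d i t)) (trans (cong (_* (γ k * v k t)) (bal t)) (*-zeroˡ (γ k * v k t))))
        where
        term : ∀ i → Dec ((i , t) ∈ S) → γ i * (d i t * v i t) ≡ d i t * (γ k * v k t)
        term i (yes i∈) = trans (solve 3 (λ g d v → g :* (d :* v) := d :* (g :* v)) refl (γ i) (d i t) (v i t))
          (cong (d i t *_) (priced i k t i∈ k∈))
        term i (no i∉) = trans (cong (λ q → γ i * (q * v i t)) (supp i t i∉))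
          (trans (solve 3 (λ g v p → g :* (con 0ℚ :* v) := con 0ℚ :* p) refl (γ i) (v i t) (γ k * v k t))
            (cong (_* (γ k * v k t)) (sym (supp i t i∉))))

    budget : ∀ {y} → Direction S (y +[ - 1ℚ ] x) → Σ (λ i → γ i * u y i) ≡ ι N
    budget {y} dir = begin
      Σ (λ i → γ i * u y i)                                    ≡⟨ Σ-cong split ⟩
      Σ (λ i → γ i * u (y +[ - 1ℚ ] x) i + 1ℚ)                 ≡⟨ Σ-+ (λ i → γ i * u (y +[ - 1ℚ ] x) i) (λ _ → 1ℚ) ⟩
      Σ (λ i → γ i * u (y +[ - 1ℚ ] x) i) + Σ {N} (λ _ → 1ℚ)   ≡⟨ cong₂ _+_ (conserved dir) (trans (Σ-const N 1ℚ) (*-identityʳ (ι N))) ⟩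
      0ℚ + ι N                                                 ≡⟨ +-identityˡ (ι N) ⟩
      ι N                                                      ∎
      where
      open ≡-Reasoning
      split : ∀ i → γ i * u y i ≡ γ i * u (y +[ - 1ℚ ] x) i + 1ℚ
      split i = trans (solve 3 (λ g a b → g :* a := g :* (a :+ con (- 1ℚ) :* b) :+ g :* b) refl (γ i) (u y i) (u x i))
        (cong₂ (λ p q → γ i * p + q) (sym (u-+ y x (- 1ℚ) i)) (unit i))

    scaled : ∀ y i → u y i ≡ u x i * (γ i * u y i)
    scaled y i = trans (sym (*-identityˡ (u y i))) (trans (cong (_* u y i) (sym (unit i)))
      (solve 3 (λ g a b → g :* a :* b := a :* (g :* b)) refl (γ i) (u x i) (u y i)))

    u-pos : ∀ i → 0ℚ < u x i
    u-pos i = *-cancelˡ-< (<⇒≤ (γ-pos i)) (subst₂ _<_ (sym (*-zeroʳ (γ i))) (sym (unit i)) 0<1)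

    -- Since `γ i * u x i` is 1, the ratio of the two products is the product of the numbers
    -- `γ i * u y i`, whose sum is `ι N` by `budget`.
    maximal : ∀ {y} → (∀ i → 0ℚ ≤ u y i) → Direction S (y +[ - 1ℚ ] x) → Π (u y) ≤ Π (u x)
    maximal {y} 0≤uy dir = begin
      Π (u y)                               ≡⟨ Π-cong (scaled y) ⟩
      Π (λ i → u x i * (γ i * u y i))       ≡⟨ Π-* (u x) (λ i → γ i * u y i) ⟩
      Π (u x) * Π (λ i → γ i * u y i)       ≤⟨ *-monoˡ (Π-nonneg (λ i → <⇒≤ (u-pos i)))
                                                 (AM-GM₁ (λ i → *-nonneg (<⇒≤ (γ-pos i)) (0≤uy i)) (≤-reflexive (budget {y} dir))) ⟩
      Π (u x) * 1ℚ                          ≡⟨ *-identityʳ (Π (u x)) ⟩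
      Π (u x)                               ∎
      where open ≤-Reasoning

    -- With a = γ·u y of mean 1, concavity is a ≤ (1 + τ(a - 1))·(a + τ(1 - a)) together with AM-GM for the first factors.
    towards-critical : ∀ {y τ} → (∀ i → 0ℚ ≤ u y i) → Direction S (y +[ - 1ℚ ] x) → 0ℚ ≤ τ → τ ≤ 1ℚ →
      Π (u y) ≤ Π (u (y +[ τ ] (x +[ - 1ℚ ] y)))
    towards-critical {y} {τ} 0≤uy dir 0≤τ τ≤1 = begin
      Π (u y)                     ≤⟨ Π-mono 0≤uy below ⟩
      Π (λ i → f i * u z i)       ≡⟨ Π-* f (u z) ⟩
      Π f * Π (u z)               ≤⟨ *-monoʳ (Π-nonneg 0≤uz) (AM-GM₁ 0≤f (≤-reflexive Σf≡)) ⟩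
      1ℚ * Π (u z)                ≡⟨ *-identityˡ (Π (u z)) ⟩
      Π (u z)                     ∎
      where
      open ≤-Reasoning
      z : Matrix N T
      z = y +[ τ ] (x +[ - 1ℚ ] y)
      a f : Fin N → ℚ
      a i = γ i * u y i
      f i = 1ℚ - τ + τ * a i
      0≤a : ∀ i → 0ℚ ≤ a i
      0≤a i = *-nonneg (<⇒≤ (γ-pos i)) (0≤uy i)
      0≤1-τ : 0ℚ ≤ 1ℚ - τ
      0≤1-τ = ≤⇒0≤- τ≤1
      0≤f : ∀ i → 0ℚ ≤ f i
      0≤f i = +-nonneg 0≤1-τ (*-nonneg 0≤τ (0≤a i))
      uz≡ : ∀ i → u z i ≡ u x i * (a i + τ * (1ℚ - a i))
      uz≡ i = trans (u-+ y (x +[ - 1ℚ ] y) τ i) (trans (cong₂ (λ p q → p + τ * q) (scaled y i)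
          (trans (u-+ x y (- 1ℚ) i) (cong (λ q → u x i + (- 1ℚ) * q) (scaled y i))))
        (solve 3 (λ U a t → U :* a :+ t :* (U :+ con (- 1ℚ) :* (U :* a)) := U :* (a :+ t :* (con 1ℚ :- a))) refl (u x i) (a i) τ))
      0≤uz : ∀ i → 0ℚ ≤ u z i
      0≤uz i = subst (0ℚ ≤_) (sym (uz≡ i)) (*-nonneg (<⇒≤ (u-pos i))
        (subst (0ℚ ≤_) (solve 2 (λ a t → (con 1ℚ :- t) :* a :+ t := a :+ t :* (con 1ℚ :- a)) refl (a i) τ)
          (+-nonneg (*-nonneg 0≤1-τ (0≤a i)) 0≤τ)))
      below : ∀ i → u y i ≤ f i * u z i
      below i = ≤-by (u x i * (τ * (1ℚ - τ) * ((a i - 1ℚ) * (a i - 1ℚ))))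
        (*-nonneg (<⇒≤ (u-pos i)) (*-nonneg (*-nonneg 0≤τ 0≤1-τ) (square-nonneg (a i - 1ℚ))))
        (trans (cong (f i *_) (uz≡ i))
          (trans (solve 3 (λ U a t → (con 1ℚ :- t :+ t :* a) :* (U :* (a :+ t :* (con 1ℚ :- a)))
              := U :* a :+ U :* (t :* (con 1ℚ :- t) :* ((a :- con 1ℚ) :* (a :- con 1ℚ)))) refl (u x i) (a i) τ)
            (cong (_+ u x i * (τ * (1ℚ - τ) * ((a i - 1ℚ) * (a i - 1ℚ)))) (sym (scaled y i)))))
      Σf≡ : Σ f ≡ ι N
      Σf≡ = trans (Σ-+ {N} (λ _ → 1ℚ - τ) (λ i → τ * a i))
        (trans (cong₂ _+_ (Σ-const N (1ℚ - τ)) (trans (Σ-*ˡ τ a) (cong (τ *_) (budget {y} dir))))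
          (solve 2 (λ n t → n :* (con 1ℚ :- t) :+ t :* n := n) refl (ι N) τ))

  -- Stationarity asks that β-weighted utility be constant on each component. Directions preserve
  -- its total over a component, so the constant can only be the average.
  module Equalize {S} (F : Forest S) (priced : ∀ i k t → Forest.Priced F i k t) (y : Matrix N T) (0<uy : ∀ i → 0ℚ < u y i) where
    open Forest F hiding (Priced)

    money : Fin N → ℚ
    money i = β i * u y i

    average : ∀ r → Σ[ a ∈ ℚ ] (0ℚ < a × Σ (λ i → δ r (root i)) * a ≡ Σ (λ i → δ r (root i) * money i))
    average r = common-mean (λ i → δ r (root i)) money (λ i → δ-nonneg r (root i)) (λ i → *-pos (β-pos i) (0<uy i))

    avg : Fin N → ℚ
    avg r = proj₁ (average r)

    surplus : Fin N → ℚ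
    surplus l = avg (root l) - money l

    -- This solves the linear stationarity equations alone: entries may come out negative, which is
    -- why `critical-dominates` distinguishes two cases.
    critical : Matrix N T
    critical = y +[ 1ℚ ] combination surplus path

    shift : Direction S (combination surplus path)
    shift = combination-direction surplus path-direction

    -- Every path draws on the root of its component; these withdrawals cancel because deviations
    -- from the average sum to zero.
    Σ-surplus : ∀ r → Σ (λ l → surplus l * δ r (root l)) ≡ 0ℚ
    Σ-surplus r = begin
      Σ (λ l → surplus l * δ r (root l))
        ≡⟨ Σ-cong (λ l → trans (solve 3 (λ a m d → (a :- m) :* d := d :* a :- d :* m) refl (avg (root l)) (money l) (δ r (root l)))
             (cong (λ q → q - δ r (root l) * money l) (δ-subst r (root l) avg))) ⟩
      Σ (λ l → δ r (root l) * avg r - δ r (root l) * money l)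
        ≡⟨ trans (Σ-- (λ l → δ r (root l) * avg r) (λ l → δ r (root l) * money l))
             (cong (λ q → q - Σ (λ l → δ r (root l) * money l)) (Σ-*ʳ (avg r) (λ l → δ r (root l)))) ⟩
      Σ (λ l → δ r (root l)) * avg r - Σ (λ l → δ r (root l) * money l)
        ≡⟨ cong (_- Σ (λ l → δ r (root l) * money l)) (proj₂ (proj₂ (average r))) ⟩
      Σ (λ l → δ r (root l) * money l) - Σ (λ l → δ r (root l) * money l)
        ≡⟨ +-inverseʳ (Σ (λ l → δ r (root l) * money l)) ⟩
      0ℚ ∎
      where open ≡-Reasoning

    critical-money : ∀ k → β k * u critical k ≡ avg (root k)
    critical-money k = begin
      β k * u critical k
        ≡⟨ cong (β k *_) (trans (u-+ y (combination surplus path) 1ℚ k) (cong (λ q → u y k + 1ℚ * q) (u-combination surplus path k))) ⟩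
      β k * (u y k + 1ℚ * Σ (λ l → surplus l * u (path l) k))
        ≡⟨ solve 3 (λ b p q → b :* (p :+ con 1ℚ :* q) := b :* p :+ b :* q) refl (β k) (u y k) (Σ (λ l → surplus l * u (path l) k)) ⟩
      money k + β k * Σ (λ l → surplus l * u (path l) k)
        ≡⟨ cong (money k +_) (sym (Σ-*ˡ (β k) (λ l → surplus l * u (path l) k))) ⟩
      money k + Σ (λ l → β k * (surplus l * u (path l) k))
        ≡⟨ cong (money k +_) (Σ-cong expand) ⟩
      money k + Σ (λ l → δ k l * surplus l - surplus l * δ k (root l))
        ≡⟨ cong (money k +_) (trans (Σ-- (λ l → δ k l * surplus l) (λ l → surplus l * δ k (root l))) (cong₂ _-_ (Σ-δ k surplus) (Σ-surplus k))) ⟩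
      money k + (avg (root k) - money k - 0ℚ)
        ≡⟨ solve 2 (λ m a → m :+ (a :- m :- con 0ℚ) := a) refl (money k) (avg (root k)) ⟩
      avg (root k) ∎
      where
      open ≡-Reasoning
      expand : ∀ l → β k * (surplus l * u (path l) k) ≡ δ k l * surplus l - surplus l * δ k (root l)
      expand l = trans (solve 3 (λ b c p → b :* (c :* p) := c :* (b :* p)) refl (β k) (surplus l) (u (path l) k))
        (trans (cong (surplus l *_) (value k l))
          (solve 3 (λ c x y → c :* (x :- y) := x :* c :- c :* y) refl (surplus l) (δ k l) (δ k (root l))))

    isCritical : Critical S critical
    isCritical = record
      { γ = λ i → avg⁻ (root i) * β i
      ; γ-pos = λ i → *-pos (proj₁ (proj₂ (inv (root i)))) (β-pos i)
      ; unit = λ i → trans (*-assoc (avg⁻ (root i)) (β i) (u critical i)) (trans (cong (avg⁻ (root i) *_) (critical-money i))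
          (trans (*-comm (avg⁻ (root i)) (avg (root i))) (proj₂ (proj₂ (inv (root i))))))
      ; priced = λ i k t i∈ k∈ → trans (*-assoc (avg⁻ (root i)) (β i) (v i t))
          (trans (cong₂ (λ r q → avg⁻ r * q) (proj₁ (priced i k t i∈ k∈)) (proj₂ (priced i k t i∈ k∈)))
            (sym (*-assoc (avg⁻ (root k)) (β k) (v k t))))
      }
      where
      inv : ∀ r → Σ[ b ∈ ℚ ] (0ℚ < b × avg r * b ≡ 1ℚ)
      inv r = inverse (proj₁ (proj₂ (average r)))
      avg⁻ : Fin N → ℚ
      avg⁻ r = proj₁ (inv r)

  -- Descent to smaller supports

  record Full (S : List (Edge N T)) (y : Matrix N T) : Set where
    field
      nonneg    : ∀ i t → 0ℚ ≤ y i t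
      columns   : ∀ t → Σ (λ i → y i t) ≡ s t
      supported : Supported S y

  u-nonneg : ∀ {y} → (∀ i t → 0ℚ ≤ y i t) → ∀ i → 0ℚ ≤ u y i
  u-nonneg 0≤y i = Σ-nonneg (λ t → *-nonneg (0≤y i t) (v-nonneg i t))

  difference : ∀ {S} {x y : Matrix N T} → Supported S x → (∀ t → Σ (λ i → x i t) ≡ s t) →
    Supported S y → (∀ t → Σ (λ i → y i t) ≡ s t) → Direction S (y +[ - 1ℚ ] x)
  difference {S} {x} {y} sx cx sy cy = direction
    (λ i t ∉S → cong₂ (λ p q → p + (- 1ℚ) * q) (sy i t ∉S) (sx i t ∉S))
    (λ t → trans (Σ-+ (λ i → y i t) (λ i → (- 1ℚ) * x i t))
      (trans (cong₂ _+_ (cy t) (trans (Σ-*ˡ (- 1ℚ) (λ i → x i t)) (cong ((- 1ℚ) *_) (cx t))))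
        (solve 1 (λ s → s :+ con (- 1ℚ) :* s := con 0ℚ) refl (s t))))

  _without_ : List (Edge N T) → Edge N T → List (Edge N T)
  S without e = filter (λ f → ¬? (f ≟ₑ e)) S

  -- The blocking entry has a negative component of `d`, and `d` is supported on `S`; hence its edge
  -- belongs to `S`, and discarding it shortens the support.
  retreat : ∀ {S y d} → Full S y → Direction S d → Σ[ i ∈ Fin N ] Σ[ t ∈ Fin T ] (d i t < 0ℚ) →
    Σ[ τ ∈ ℚ ] (0ℚ ≤ τ × Σ[ e ∈ Edge N T ] (e ∈ S × Full (S without e) (y +[ τ ] d)))
  retreat {S} {y} {d} full dir (i₀ , t₀ , d<0) = by-cases (boundary-step p q 0≤p edges)
    where
    open Full full
    edges : List (Edge N T)
    edges = cartesianProduct (allFin N) (allFin T)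
    ∈edges : ∀ i t → (i , t) ∈ edges
    ∈edges i t = ∈-cartesianProduct⁺ (∈-allFin i) (∈-allFin t)
    p q : Edge N T → ℚ
    p (i , t) = y i t
    q (i , t) = d i t
    0≤p : ∀ e → 0ℚ ≤ p e
    0≤p (i , t) = nonneg i t
    Result : Set
    Result = Σ[ τ ∈ ℚ ] (0ℚ ≤ τ × Σ[ e ∈ Edge N T ] (e ∈ S × Full (S without e) (y +[ τ ] d)))
    by-cases : All (λ x → 0ℚ ≤ q x) edges ⊎
      (Σ[ τ ∈ ℚ ] (0ℚ ≤ τ × All (λ x → 0ℚ ≤ p x + τ * q x) edges × Σ[ x ∈ Edge N T ] (q x < 0ℚ × p x + τ * q x ≡ 0ℚ))) → Result
    by-cases (inj₁ 0≤q) = ⊥-elim (<-irrefl refl (<-≤-trans d<0 (All.lookup 0≤q (∈edges i₀ t₀))))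
    by-cases (inj₂ (τ , 0≤τ , all , (i , t) , d<0 , at)) = τ , 0≤τ , (i , t) , in-S ((i , t) ∈? S) , record
      { nonneg = λ j t′ → All.lookup all (∈edges j t′)
      ; columns = λ t′ → trans (column-+ {x = y} τ dir t′) (columns t′)
      ; supported = λ j t′ e∉ → off j t′ e∉ ((j , t′) ≟ₑ (i , t))
      }
      where
      in-S : Dec ((i , t) ∈ S) → (i , t) ∈ S
      in-S (yes e∈) = e∈
      in-S (no e∉) = ⊥-elim (<-irrefl (Direction.supported dir i t e∉) d<0)
      off : ∀ j t′ → (j , t′) ∉ (S without (i , t)) → Dec ((j , t′) ≡ (i , t)) → (y +[ τ ] d) j t′ ≡ 0ℚ
      off j t′ e∉ (yes refl) = at
      off j t′ e∉ (no e≢) = +-supported τ supported dir j t′ (λ e∈ → e∉ (∈-filter⁺ (λ f → ¬? (f ≟ₑ (i , t))) e∈ e≢))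

  -- `b` ranges over all allocations, so the best of the allocations found for the faces can be
  -- tried as a candidate for `S` itself.
  Dominates : Matrix N T → List (Edge N T) → Set
  Dominates b S = ∀ y → Full S y → Π (u y) ≤ Π (u b)

  Dominated : List (Edge N T) → Set
  Dominated S = Σ[ b ∈ Matrix N T ] (IsAllocation I b × Dominates b S)

  -- Here `y` beats a `b` that is at least as good as everything on the faces of `S`. So `y` cannot
  -- be moved onto a face without loss, and each attempt to do so is a contradiction.
  module _ {S b} (alloc : IsAllocation I b) (faces : ∀ e → e ∈ S → Dominates b (S without e))
    {y} (full : Full S y) (better : Π (u b) < Π (u y)) where
    open Full full

    0≤uy : ∀ i → 0ℚ ≤ u y i
    0≤uy = u-nonneg {y} nonneg

    0<uy : ∀ i → 0ℚ < u y i
    0<uy = Π>0⇒factor>0 0≤uy (≤-<-trans (Π-nonneg (u-nonneg {b} (proj₁ alloc))) better)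

    on-a-face : ∀ {z e} → e ∈ S → Full (S without e) z → Π (u y) ≤ Π (u z) → ⊥
    on-a-face {z} e∈ fz le = <-irrefl refl (<-≤-trans better (≤-trans le (faces _ e∈ z fz)))

    not-improving : Improving S → ⊥
    not-improving imp = from (retreat full isDirection decrease)
      where
      open Improving imp
      from : Σ[ τ ∈ ℚ ] (0ℚ ≤ τ × Σ[ e ∈ Edge N T ] (e ∈ S × Full (S without e) (y +[ τ ] d))) → ⊥
      from (τ , 0≤τ , e , e∈ , fz) = on-a-face e∈ fz (Π-mono 0≤uy
        (λ i → ≤-by (τ * u d i) (*-nonneg 0≤τ (gain i)) (u-+ y d τ i)))

    critical-dominates : Σ[ F ∈ Forest S ] (∀ i k t → Forest.Priced F i k t) → Dominated S
    critical-dominates (F , priced) = by-sign (FinP.any? (λ i → FinP.any? (λ t → x i t <? 0ℚ)))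
      where
      open Equalize F priced y 0<uy renaming (critical to x)
      x-supported : Supported S x
      x-supported = +-supported 1ℚ supported shift
      x-columns : ∀ t → Σ (λ i → x i t) ≡ s t
      x-columns t = trans (column-+ {x = y} 1ℚ shift t) (columns t)
      by-sign : Dec (Σ[ i ∈ Fin N ] Σ[ t ∈ Fin T ] (x i t < 0ℚ)) → Dominated S
      by-sign (no none) = x , ((λ i t → ≮⇒≥ (λ lt → none (i , t , lt))) , (λ t → ≤-reflexive (x-columns t))) ,
        (λ z fz → Critical.maximal isCritical {z} (u-nonneg {z} (Full.nonneg fz))
          (difference {x = x} {z} x-supported x-columns (Full.supported fz) (Full.columns fz)))
      by-sign (yes (i , t , x<0)) = ⊥-elim (from (retreat full toward (i , t , d<0)))
        where
        toward : Direction S (x +[ - 1ℚ ] y)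
        toward = difference {x = y} {x} supported columns x-supported x-columns
        d<0 : x i t + (- 1ℚ) * y i t < 0ℚ
        d<0 = ≤-<-trans (≤-by (y i t) (nonneg i t)
          (solve 2 (λ x y → x := x :+ con (- 1ℚ) :* y :+ y) refl (x i t) (y i t))) x<0
        from : Σ[ τ ∈ ℚ ] (0ℚ ≤ τ × Σ[ e ∈ Edge N T ] (e ∈ S × Full (S without e) (y +[ τ ] (x +[ - 1ℚ ] y)))) → ⊥
        from (τ , 0≤τ , e , e∈ , fz) = on-a-face e∈ fz (Critical.towards-critical isCritical {y} 0≤uy
            (difference {x = x} {y} x-supported x-columns supported columns) 0≤τ (≮⇒≥ past-x))
          where
          -- Beyond `x` the entry that is negative at `x` is at most `τ * x i t`, hence still
          -- negative, but the stopping point is nonnegative.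
          past-x : ¬ (1ℚ < τ)
          past-x 1<τ = <-irrefl refl (≤-<-trans (Full.nonneg fz i t) (≤-<-trans
            (≤-by ((τ - 1ℚ) * y i t) (*-nonneg (<⇒≤ (<⇒0<- 1<τ)) (nonneg i t))
              (solve 3 (λ x y t → t :* x := y :+ t :* (x :+ con (- 1ℚ) :* y) :+ (t :- con 1ℚ) :* y) refl (x i t) (y i t) τ))
            (subst (τ * x i t <_) (*-zeroʳ τ) (*-monoˡ-< (<-trans 0<1 1<τ) x<0))))

  _>>=_ : ∀ {A B : Set} → ¬ ¬ A → (A → ¬ ¬ B) → ¬ ¬ B
  (¬¬a >>= f) k = ¬¬a (λ a → f a k)

  -- The only appeal to excluded middle: whether some full assignment beats `b` is a question about
  -- infinitely many matrices. This is where the double negation enters.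
  from-faces : ∀ {S b} → IsAllocation I b → (∀ e → e ∈ S → Dominates b (S without e)) → ¬ ¬ Dominated S
  from-faces {S} {b} alloc faces =
    ¬¬-excluded-middle {A = Σ[ y ∈ Matrix N T ] (Full S y × Π (u b) < Π (u y))} >>= λ
      { (no none) k → k (b , alloc , λ y full → ≮⇒≥ (λ lt → none (y , full , lt)))
      ; (yes (y , full , better)) k → k (Sum.[ (λ imp → ⊥-elim (not-improving alloc faces full better imp)) ,
          critical-dominates alloc faces full better ]′ (improving⊎forest S)) }

  best-of : ∀ S es → (∀ {e} → e ∈ es → ¬ ¬ Dominated (S without e)) →
    ¬ ¬ (Σ[ b ∈ Matrix N T ] (IsAllocation I b × (∀ e → e ∈ es → Dominates b (S without e))))
  best-of S [] h k = k ((λ _ _ → 0ℚ) , ((λ _ _ → ≤-refl) , (λ t → ≤-trans (≤-reflexive (Σ-0 N)) (<⇒≤ (s-pos t)))) , λ _ ())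
  best-of S (e ∷ es) h = h (here refl) >>= λ { (c , c-alloc , c-dom) →
    best-of S es (λ e∈ → h (there e∈)) >>= λ { (b , b-alloc , b-dom) k → k (better-of c c-alloc c-dom b b-alloc b-dom (≤-total (Π (u c)) (Π (u b)))) } }
    where
    better-of : ∀ c → IsAllocation I c → Dominates c (S without e) →
      ∀ b → IsAllocation I b → (∀ f → f ∈ es → Dominates b (S without f)) →
      Π (u c) ≤ Π (u b) ⊎ Π (u b) ≤ Π (u c) →
      Σ[ b ∈ Matrix N T ] (IsAllocation I b × (∀ f → f ∈ (e ∷ es) → Dominates b (S without f)))
    better-of c ca cd b ba bd (inj₁ c≤b) = b , ba ,
      λ { f (here refl) y fy → ≤-trans (cd y fy) c≤b ; f (there f∈) → bd f f∈ }
    better-of c ca cd b ba bd (inj₂ b≤c) = c , ca ,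
      λ { f (here refl) → cd ; f (there f∈) y fy → ≤-trans (bd f f∈ y fy) b≤c }

  dominated : ∀ n S → length S ℕ.< n → ¬ ¬ Dominated S
  dominated (suc n) S (ℕ.s≤s |S|≤n) = best-of S S (λ {e} e∈ → dominated n (S without e)
      (ℕP.<-≤-trans (filter-notAll (λ f → ¬? (f ≟ₑ e)) S (Any.map (λ { refl e≢ → e≢ refl }) e∈)) |S|≤n))
    >>= λ { (b , alloc , faces) → from-faces alloc faces }

maximizer-exists : ∀ {n T} (I : Instance (suc n) T) → ¬ ¬ (Σ[ x ∈ Matrix (suc n) T ] IsNWMaximizer I x)
maximizer-exists {n} {T} I = dominated (suc (length edges)) edges ℕP.≤-refl >>= λ { (b , alloc , dom) k →
  k (b , alloc , λ y y-alloc → ≤-trans (Π-mono (u-nonneg {y} (proj₁ y-alloc)) (fill-better y-alloc)) (dom (fill y) (fill-full y-alloc))) }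
  where
  open Instance I
  open Directions I
  open Existence I
  edges : List (Edge (suc n) T)
  edges = cartesianProduct (allFin (suc n)) (allFin T)
  -- The induction compares full assignments only. An arbitrary allocation is completed by giving
  -- agent `fzero` what remains of each item, which lowers no utility.
  leftover : Matrix (suc n) T → Fin T → ℚ
  leftover y t = s t - Σ (λ i → y i t)
  fill : Matrix (suc n) T → Matrix (suc n) T
  fill y i t = y i t + δ fzero i * leftover y t
  fill-more : ∀ {y} → IsAllocation I y → ∀ i t → y i t ≤ fill y i t
  fill-more (_ , cols) i t = a≤a+r (*-nonneg (δ-nonneg fzero i) (≤⇒0≤- (cols t)))
  fill-better : ∀ {y} → IsAllocation I y → ∀ i → u y i ≤ u (fill y) i
  fill-better alloc i = Σ-mono (λ t → *-monoʳ (v-nonneg i t) (fill-more alloc i t))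
  fill-full : ∀ {y} → IsAllocation I y → Full edges (fill y)
  fill-full {y} alloc = record
    { nonneg = λ i t → ≤-trans (proj₁ alloc i t) (fill-more alloc i t)
    ; columns = λ t → trans (Σ-+ (λ i → y i t) (λ i → δ fzero i * leftover y t))
        (trans (cong (Σ (λ i → y i t) +_) (Σ-δ {suc n} fzero (λ _ → leftover y t)))
          (solve 2 (λ a b → a :+ (b :- a) := b) refl (Σ (λ i → y i t)) (s t)))
    ; supported = λ i t e∉ → ⊥-elim (e∉ (∈-cartesianProduct⁺ (∈-allFin i) (∈-allFin t)))
    }

-- Water levels and rounding

ΣBelow-zero : ∀ {n} (f : Fin (suc n) → ℚ) → ΣBelow fzero f ≡ 0ℚ
ΣBelow-zero {n} f = Σ-zero {suc n} (λ k → if-no {x = f k} (toℕ k ℕ.<? 0) (λ ()))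

ΣBelow-suc : ∀ {n} (m : Fin n) (f : Fin (suc n) → ℚ) → ΣBelow (fsuc m) f ≡ f fzero + ΣBelow m (f ∘ fsuc)
ΣBelow-suc m f = cong₂ _+_ (if-yes {x = f fzero} {0ℚ} (0 ℕ.<? suc (toℕ m)) (ℕ.s≤s ℕ.z≤n)) (Σ-cong shift)
  where
  shift : ∀ k → (if ⌊ suc (toℕ k) ℕ.<? suc (toℕ m) ⌋ then f (fsuc k) else 0ℚ) ≡
    (if ⌊ toℕ k ℕ.<? toℕ m ⌋ then f (fsuc k) else 0ℚ)
  shift k = by-cases (toℕ k ℕ.<? toℕ m)
    where
    by-cases : Dec (toℕ k ℕ.< toℕ m) → (if ⌊ suc (toℕ k) ℕ.<? suc (toℕ m) ⌋ then f (fsuc k) else 0ℚ) ≡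
      (if ⌊ toℕ k ℕ.<? toℕ m ⌋ then f (fsuc k) else 0ℚ)
    by-cases (yes lt) = trans (if-yes (suc (toℕ k) ℕ.<? suc (toℕ m)) (ℕ.s≤s lt)) (sym (if-yes (toℕ k ℕ.<? toℕ m) lt))
    by-cases (no ≮) = trans (if-no (suc (toℕ k) ℕ.<? suc (toℕ m)) (λ { (ℕ.s≤s lt) → ≮ lt })) (sym (if-no (toℕ k ℕ.<? toℕ m) ≮))

-- A general `G` lets the same lemma sum capped increments over the sub-items of one item, where the
-- utility from earlier items is an offset inside `G`, and then over the items.
ΣBelow-telescope : ∀ {n} (G : ℚ → ℚ) (f : Fin n → ℚ) →
  Σ (λ m → G (ΣBelow m f + f m) - G (ΣBelow m f)) ≡ G (Σ f) - G 0ℚ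
ΣBelow-telescope {zero}  G f = sym (+-inverseʳ (G 0ℚ))
ΣBelow-telescope {suc n} G f = begin
  G (ΣBelow fzero f + f₀) - G (ΣBelow fzero f) + Σ (λ m → G (ΣBelow (fsuc m) f + f (fsuc m)) - G (ΣBelow (fsuc m) f))
    ≡⟨ cong₂ _+_ (cong₂ (λ p q → G p - G q) (trans (cong (_+ f₀) (ΣBelow-zero f)) (+-comm 0ℚ f₀)) (ΣBelow-zero f))
         (Σ-cong (λ m → cong₂ (λ p q → G p - G q)
           (trans (cong (_+ f (fsuc m)) (ΣBelow-suc m f)) (+-assoc f₀ (ΣBelow m (f ∘ fsuc)) (f (fsuc m)))) (ΣBelow-suc m f))) ⟩
  G (f₀ + 0ℚ) - G 0ℚ + Σ (λ m → G (f₀ + (ΣBelow m (f ∘ fsuc) + f (fsuc m))) - G (f₀ + ΣBelow m (f ∘ fsuc)))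
    ≡⟨ cong (G (f₀ + 0ℚ) - G 0ℚ +_) (ΣBelow-telescope (λ x → G (f₀ + x)) (f ∘ fsuc)) ⟩
  G (f₀ + 0ℚ) - G 0ℚ + (G (f₀ + Σ (f ∘ fsuc)) - G (f₀ + 0ℚ))
    ≡⟨ solve 3 (λ a b c → a :- b :+ (c :- a) := c :- b) refl (G (f₀ + 0ℚ)) (G 0ℚ) (G (f₀ + Σ (f ∘ fsuc))) ⟩
  G (f₀ + Σ (f ∘ fsuc)) - G 0ℚ ∎
  where
  open ≡-Reasoning
  f₀ = f fzero

ΣBelow-nonneg : ∀ {n} m {f : Fin n → ℚ} → (∀ k → 0ℚ ≤ f k) → 0ℚ ≤ ΣBelow m f
ΣBelow-nonneg m {f} 0≤f = Σ-nonneg term-nonneg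
  where
  term-nonneg : ∀ k → 0ℚ ≤ (if ⌊ toℕ k ℕ.<? toℕ m ⌋ then f k else 0ℚ)
  term-nonneg k with toℕ k ℕ.<? toℕ m
  ... | yes _ = 0≤f k
  ... | no _  = ≤-refl

ΣBelow+term≤Σ : ∀ {n} m {f : Fin n → ℚ} → (∀ k → 0ℚ ≤ f k) → ΣBelow m f + f m ≤ Σ f
ΣBelow+term≤Σ fzero {f} 0≤f = ≤-trans (≤-reflexive (trans (cong (_+ f fzero) (ΣBelow-zero f)) (+-identityˡ (f fzero)))) (a≤a+r (Σ-nonneg (0≤f ∘ fsuc)))
ΣBelow+term≤Σ (fsuc m) {f} 0≤f = ≤-trans
  (≤-reflexive (trans (cong (_+ f (fsuc m)) (ΣBelow-suc m f)) (+-assoc (f fzero) (ΣBelow m (f ∘ fsuc)) (f (fsuc m)))))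
  (+-monoʳ-≤ (f fzero) (ΣBelow+term≤Σ m (0≤f ∘ fsuc)))

yes⇒true : ∀ {A : Set} (d : Dec A) → A → ⌊ d ⌋ ≡ true
yes⇒true (yes _) _ = refl
yes⇒true (no ¬a) a = ⊥-elim (¬a a)

-- The difference `c ⊓ b - c ⊓ a` is the part of the rise from `a` to `b` that takes place below the
-- level `c`.
cap-mono : ∀ c {a b} → a ≤ b → 0ℚ ≤ c ⊓ b - c ⊓ a
cap-mono c a≤b = ≤⇒0≤- (⊓-monoʳ-≤ c a≤b)

-- When an interested agent ends at or below the cap c, every receiver of the sub-item is at most at its
-- level afterwards, so the whole supply turns into utility below c.
greedy-charge : ∀ {N} {a w : Fin N → ℚ} {σ y θ} (x U : Fin N → ℚ) c → (∀ i → 0ℚ ≤ a i) → 0ℚ ≤ θ →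
  (∀ i → w i ≡ 0ℚ ⊎ w i ≡ θ) → 0ℚ < σ → IsGreedyStep a w σ y → (∀ i → 0ℚ ≤ x i) → Σ x ≤ σ →
  (∀ i → a i + w i * y i ≤ U i) →
  Σ (λ i → if ⌊ U i ≤? c ⌋ then w i * x i else 0ℚ) ≤ Σ (λ i → c ⊓ (a i + w i * y i) - c ⊓ a i)
greedy-charge {N} {a} {w} {σ} {y} {θ} x U c 0≤a 0≤θ two-valued 0<σ step 0≤x Σx≤σ final≤U =
  by-cases (FinP.any? (λ k → (U k ≤? c) ×-dec (0ℚ <? w k)))
  where
  0≤w : ∀ i → 0ℚ ≤ w i
  0≤w i = Sum.[ (λ eq → ≤-reflexive (sym eq)) , (λ eq → subst (0ℚ ≤_) (sym eq) 0≤θ) ]′ (two-valued i)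
  0≤y : ∀ i → 0ℚ ≤ y i
  0≤y = proj₁ (proj₁ step)
  B : Fin N → Bool
  B i = ⌊ 0ℚ <? a i + w i * σ ⌋
  open ColumnOptimum a w B σ y 0≤w 0≤y (proj₂ (proj₁ step)) (proj₂ step) (greedy-factor-pos 0≤a 0≤w 0<σ step)
  charged increment : Fin N → ℚ
  charged i = if ⌊ U i ≤? c ⌋ then w i * x i else 0ℚ
  increment i = c ⊓ final i - c ⊓ a i
  0≤increment : ∀ i → 0ℚ ≤ increment i
  0≤increment i = cap-mono c (a≤a+r (*-nonneg (0≤w i) (0≤y i)))
  by-cases : Dec (∃ λ k → U k ≤ c × 0ℚ < w k) → Σ charged ≤ Σ increment
  by-cases (no none) = Σ-mono (λ i → ≤-trans (uncharged i (U i ≤? c)) (0≤increment i))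
    where
    uncharged : ∀ i → Dec (U i ≤ c) → charged i ≤ 0ℚ
    uncharged i (no U≰c) = ≤-reflexive (if-no (U i ≤? c) U≰c)
    uncharged i (yes U≤c) = ≤-reflexive (trans (if-yes (U i ≤? c) U≤c)
      (trans (cong (_* x i) (≤-antisym (≮⇒≥ (λ lt → none (i , U≤c , lt))) (0≤w i))) (*-zeroˡ (x i))))
  by-cases (yes (k , Uk≤c , 0<wk)) = begin
    Σ charged              ≤⟨ Σ-mono (λ i → charged≤ i (U i ≤? c)) ⟩
    Σ (λ i → θ * x i)      ≡⟨ Σ-*ˡ θ x ⟩
    θ * Σ x                ≤⟨ *-monoˡ 0≤θ Σx≤σ ⟩
    θ * σ                  ≡⟨ cong (θ *_) (sym (exhausted Bk 0<wk)) ⟩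
    θ * Σ y                ≡⟨ sym (Σ-*ˡ θ y) ⟩
    Σ (λ i → θ * y i)      ≤⟨ Σ-mono (λ i → received i (≤-split (0≤y i))) ⟩
    Σ increment            ∎
    where
    open ≤-Reasoning
    w≤θ : ∀ i → w i ≤ θ
    w≤θ i = Sum.[ (λ eq → subst (_≤ θ) (sym eq) 0≤θ) , ≤-reflexive ]′ (two-valued i)
    positive⇒θ : ∀ {i} → 0ℚ < w i → w i ≡ θ
    positive⇒θ {i} 0<wi = Sum.[ (λ eq → ⊥-elim (<-irrefl (sym eq) 0<wi)) , (λ eq → eq) ]′ (two-valued i)
    Bk : B k ≡ true
    Bk = yes⇒true (0ℚ <? a k + w k * σ) (<-≤-trans (*-pos 0<wk 0<σ)
      (≤-by (a k) (0≤a k) (+-comm (a k) (w k * σ))))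
    charged≤ : ∀ i → Dec (U i ≤ c) → charged i ≤ θ * x i
    charged≤ i (yes U≤c) = ≤-trans (≤-reflexive (if-yes (U i ≤? c) U≤c)) (*-monoʳ (0≤x i) (w≤θ i))
    charged≤ i (no U≰c) = ≤-trans (≤-reflexive (if-no (U i ≤? c) U≰c)) (*-nonneg 0≤θ (0≤x i))
    received : ∀ i → 0ℚ < y i ⊎ 0ℚ ≡ y i → θ * y i ≤ increment i
    received i (inj₂ 0≡y) = ≤-trans (≤-reflexive (trans (cong (θ *_) (sym 0≡y)) (*-zeroʳ θ))) (0≤increment i)
    received i (inj₁ 0<y) = ≤-reflexive (begin-equality
      θ * y i             ≡⟨ solve 3 (λ t y a → t :* y := a :+ t :* y :- a) refl θ (y i) (a i) ⟩
      a i + θ * y i - a i ≡⟨ cong (λ q → a i + q * y i - a i) (sym wi≡θ) ⟩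
      final i - a i       ≡⟨ cong₂ _-_ (sym (p≥q⇒p⊓q≡q final≤c)) (sym (p≥q⇒p⊓q≡q (≤-trans (a≤a+r (*-nonneg (0≤w i) (0≤y i))) final≤c))) ⟩
      increment i         ∎)
      where
      eq-ineq : w k * final i ≤ w i * final k
      eq-ineq = equilibrium Bk 0<wk 0<y
      0<final : 0ℚ < final i
      0<final = greedy-factor-pos 0≤a 0≤w 0<σ step i (receives⇒active Bk 0<wk 0<y)
      -- A receiver must value the sub-item: otherwise the equilibrium inequality would bound a
      -- positive number by zero.
      not-zero : w i ≢ 0ℚ
      not-zero wi≡0 = <-irrefl refl (<-≤-trans (*-pos 0<wk 0<final)
        (≤-trans eq-ineq (≤-reflexive (trans (cong (_* final k) wi≡0) (*-zeroˡ (final k))))))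
      wi≡θ : w i ≡ θ
      wi≡θ = Sum.[ (λ eq → ⊥-elim (not-zero eq)) , (λ eq → eq) ]′ (two-valued i)
      -- This is where rounding pays: both agents have value `θ`, which cancels from the equilibrium
      -- inequality and leaves a direct comparison of their levels.
      final≤c : final i ≤ c
      final≤c = ≤-trans (*-cancelˡ-≤ 0<wk (≤-trans eq-ineq
        (≤-reflexive (cong (_* final k) (trans wi≡θ (sym (positive⇒θ 0<wk))))))) (≤-trans (final≤U k) Uk≤c)

-- Rounding to dyadic thresholds

½-nonneg : 0ℚ ≤ ½
½-nonneg = nonNegative⁻¹ ½

keep : ℚ → ℚ → ℚ
keep v thr = if ⌊ thr ≤? v ⌋ then thr else 0ℚ

keep-yes : ∀ {v thr} → thr ≤ v → keep v thr ≡ thr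
keep-yes {v} {thr} h = if-yes (thr ≤? v) h

keep-nonneg : ∀ v {thr} → 0ℚ ≤ thr → 0ℚ ≤ keep v thr
keep-nonneg v {thr} h with thr ≤? v
... | yes _ = h
... | no _  = ≤-refl

keep≤ : ∀ {v thr} → 0ℚ ≤ v → keep v thr ≤ v
keep≤ {v} {thr} 0≤v with thr ≤? v
... | yes le = le
... | no _   = 0≤v

keep-two-valued : ∀ v thr → keep v thr ≡ 0ℚ ⊎ keep v thr ≡ thr
keep-two-valued v thr with thr ≤? v
... | yes _ = inj₂ refl
... | no _  = inj₁ refl

-- The largest kept threshold q/2ʲ ≤ v is at least v/2.
rounding-covers : ∀ L {q v} → 0ℚ ≤ q → v ≤ q → q ≤ 2ℚ ^ suc L * v →
  v ≤ 2ℚ * Σ {suc L} (λ j → keep v (q * (½ ^ suc (toℕ j))))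
rounding-covers L {q} {v} 0≤q v≤q q≤ = by-cases (q * (½ * 1ℚ) ≤? v)
  where
  terms : Fin (suc L) → ℚ
  terms j = keep v (q * (½ ^ suc (toℕ j)))
  Goal : Set
  Goal = v ≤ 2ℚ * Σ terms
  thr-nonneg : ∀ j → 0ℚ ≤ q * (½ ^ suc j)
  thr-nonneg j = *-nonneg 0≤q (^-nonneg ½-nonneg (suc j))
  double-half : ∀ q → 2ℚ * (q * (½ * 1ℚ)) ≡ q
  double-half q = solve 1 (λ q → con 2ℚ :* (q :* (con ½ :* con 1ℚ)) := q) refl q
  by-cases : Dec (q * (½ * 1ℚ) ≤ v) → Goal
  by-cases (yes le) = ≤-trans (≤-trans v≤q (≤-reflexive (trans (sym (double-half q)) (cong (2ℚ *_) (sym (keep-yes le))))))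
    (*-monoˡ (<⇒≤ 0<2) (term≤Σ {suc L} (λ j → keep-nonneg v (thr-nonneg (toℕ j))) fzero))
  by-cases (no ≰) = finer L q≤ refl
    where
    small : v < q * (½ * 1ℚ)
    small = ≰⇒> ≰
    finer : ∀ ℓ → q ≤ 2ℚ ^ suc ℓ * v → ℓ ≡ L → Goal
    finer zero q≤2v _ = ⊥-elim (<-irrefl refl (<-≤-trans (*-monoˡ-< 0<2 small) (≤-trans (≤-reflexive (double-half q))
      (≤-trans q≤2v (≤-reflexive (solve 1 (λ v → con 2ℚ :* con 1ℚ :* v := con 2ℚ :* v) refl v))))))
    -- Below the first threshold, `q` may be halved. The thresholds of the smaller problem are the
    -- remaining ones of this problem, and the allowed ratio drops by the same factor 2.
    finer (suc ℓ) q≤ refl = ≤-trans (rounding-covers ℓ (*-nonneg 0≤q ½-nonneg)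
        (≤-trans (<⇒≤ small) (≤-reflexive (cong (q *_) (*-identityʳ ½))))
        (*-cancelˡ-≤ 0<2 (≤-trans (≤-reflexive (solve 1 (λ q → con 2ℚ :* (q :* con ½) := q) refl q))
          (≤-trans q≤ (≤-reflexive (solve 2 (λ p v → con 2ℚ :* p :* v := con 2ℚ :* (p :* v)) refl (2ℚ ^ suc ℓ) v))))))
      (*-monoˡ (<⇒≤ 0<2) (≤-trans
        (≤-reflexive (Σ-cong {suc ℓ} (λ j → cong (keep v) (*-assoc q ½ (½ ^ suc (toℕ j))))))
        (≤-by (terms fzero) (keep-nonneg v (thr-nonneg 0)) (+-comm (terms fzero) (Σ (λ j → terms (fsuc j)))))))

Max-upper : ∀ {n} (f : Fin n → ℚ) i → f i ≤ Max f
Max-upper f fzero    = p≤p⊔q (f fzero) (Max (f ∘ fsuc))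
Max-upper f (fsuc i) = ≤-trans (Max-upper (f ∘ fsuc) i) (p≤q⊔p (f fzero) (Max (f ∘ fsuc)))

Max-least : ∀ {n} {f : Fin n → ℚ} {c} → 0ℚ ≤ c → (∀ i → f i ≤ c) → Max f ≤ c
Max-least {zero}  0≤c h = 0≤c
Max-least {suc n} 0≤c h = ⊔-lub (h fzero) (Max-least 0≤c (h ∘ fsuc))

-- Comparison with a maximizer

recipℕ-inverse : ∀ n → ι (suc n) * recipℕ (suc n) ≡ 1ℚ
recipℕ-inverse n = trans (cong (_* recipℕ (suc n)) (ι≡ℕtoℚ (suc n))) (toℚᵘ-injective
  (ℚᵘP.≃-trans (toℚᵘ-homo-* (ℕtoℚ (suc n)) (recipℕ (suc n)))
    (ℚᵘP.≃-trans (ℚᵘP.*-cong (toℚᵘ-fromℚᵘ (ℚᵘ.mkℚᵘ (ℤ.+ suc n) 0)) (toℚᵘ-fromℚᵘ (ℚᵘ.mkℚᵘ (ℤ.+ 1) n))) (ℚᵘ.*≡* (ring (ℤ.+ suc n))))))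
  where
  ring : ∀ i → i ℤ.* ℤ.+ 1 ℤ.* ℤ.+ 1 ≡ ℤ.+ 1 ℤ.* (ℤ.+ 1 ℤ.* i)
  ring = ℤSolver.solve-∀

recipℕ-pos : ∀ n → 0ℚ < recipℕ (suc n)
recipℕ-pos n = *-cancelˡ-< (ι-nonneg (suc n)) (subst₂ _<_ (sym (*-zeroʳ (ι (suc n)))) (sym (recipℕ-inverse n)) 0<1)

-- Each column of a Nash welfare maximizer solves the greedy problem against the rest of its utilities.
module MaximizerColumn {N T} (I : Instance N T) {x : Matrix N T} (max : IsNWMaximizer I x)
  (0<u : ∀ i → 0ℚ < utility I x i) (t : Fin T) where
  open Instance I

  rest : Fin N → ℚ
  rest i = utility I x i - x i t * v i t

  replace : (Fin N → ℚ) → Matrix N T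
  replace z i t′ = x i t′ + δ t t′ * (z i - x i t)

  replace-entry : ∀ z i t′ → (t ≡ t′ × replace z i t′ ≡ z i) ⊎ replace z i t′ ≡ x i t′
  replace-entry z i t′ = by-cases (t FinP.≟ t′)
    where
    by-cases : Dec (t ≡ t′) → (t ≡ t′ × replace z i t′ ≡ z i) ⊎ replace z i t′ ≡ x i t′
    by-cases (yes refl) = inj₁ (refl , trans (cong (λ d → x i t + d * (z i - x i t)) (δ-refl t))
      (solve 2 (λ x z → x :+ con 1ℚ :* (z :- x) := z) refl (x i t) (z i)))
    by-cases (no ≢) = inj₂ (trans (cong (λ d → x i t′ + d * (z i - x i t)) (δ-≢ ≢))
      (solve 2 (λ x y → x :+ con 0ℚ :* y := x) refl (x i t′) (z i - x i t)))

  replace-column : ∀ z t′ → Σ (λ i → replace z i t′) ≡ Σ (λ i → x i t′) + δ t t′ * (Σ z - Σ (λ i → x i t))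
  replace-column z t′ = trans (Σ-+ (λ i → x i t′) (λ i → δ t t′ * (z i - x i t)))
    (cong (Σ (λ i → x i t′) +_) (trans (Σ-*ˡ (δ t t′) (λ i → z i - x i t)) (cong (δ t t′ *_) (Σ-- z (λ i → x i t)))))

  replace-allocation : ∀ {z} → (∀ i → 0ℚ ≤ z i) × Σ z ≤ s t → IsAllocation I (replace z)
  replace-allocation {z} (0≤z , Σz≤s) =
    (λ i t′ → Sum.[ (λ { (_ , eq) → subst (0ℚ ≤_) (sym eq) (0≤z i) }) ,
                         (λ eq → subst (0ℚ ≤_) (sym eq) (proj₁ (proj₁ max) i t′)) ]′ (replace-entry z i t′)) ,
    (λ t′ → column t′ (t FinP.≟ t′))
    where
    column : ∀ t′ → Dec (t ≡ t′) → Σ (λ i → replace z i t′) ≤ s t′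
    column t′ (yes refl) = subst (_≤ s t) (sym (trans (replace-column z t)
      (trans (cong (λ d → Σ (λ i → x i t) + d * (Σ z - Σ (λ i → x i t))) (δ-refl t))
        (solve 2 (λ a b → a :+ con 1ℚ :* (b :- a) := b) refl (Σ (λ i → x i t)) (Σ z))))) Σz≤s
    column t′ (no ≢) = subst (_≤ s t′) (sym (trans (replace-column z t′)
      (trans (cong (λ d → Σ (λ i → x i t′) + d * (Σ z - Σ (λ i → x i t))) (δ-≢ ≢))
        (solve 2 (λ a b → a :+ con 0ℚ :* b := a) refl (Σ (λ i → x i t′)) (Σ z - Σ (λ i → x i t)))))) (proj₂ (proj₁ max) t′)

  replace-utility : ∀ z i → utility I (replace z) i ≡ rest i + v i t * z i
  replace-utility z i = begin
    utility I (replace z) i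
      ≡⟨ Σ-cong (λ t′ → solve 4 (λ x d e v → (x :+ d :* e) :* v := x :* v :+ d :* (e :* v)) refl (x i t′) (δ t t′) (z i - x i t) (v i t′)) ⟩
    Σ (λ t′ → x i t′ * v i t′ + δ t t′ * ((z i - x i t) * v i t′))
      ≡⟨ trans (Σ-+ (λ t′ → x i t′ * v i t′) (λ t′ → δ t t′ * ((z i - x i t) * v i t′)))
           (cong (utility I x i +_) (Σ-δ t (λ t′ → (z i - x i t) * v i t′))) ⟩
    utility I x i + (z i - x i t) * v i t
      ≡⟨ solve 4 (λ u z x v → u :+ (z :- x) :* v := u :- x :* v :+ v :* z) refl (utility I x i) (z i) (x i t) (v i t) ⟩
    rest i + v i t * z i ∎
    where open ≡-Reasoning

  final≡ : ∀ i → rest i + v i t * x i t ≡ utility I x i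
  final≡ i = solve 3 (λ u x v → u :- x :* v :+ v :* x := u) refl (utility I x i) (x i t) (v i t)

  optimal : ∀ z → (∀ i → 0ℚ ≤ z i) × Σ z ≤ s t → Π (λ i → rest i + v i t * z i) ≤ Π (λ i → rest i + v i t * x i t)
  optimal z feasible = subst₂ _≤_ (Π-cong (replace-utility z)) (sym (Π-cong final≡))
    (proj₂ max (replace z) (replace-allocation feasible))

  open ColumnOptimum rest (λ i → v i t) (λ _ → true) (s t) (λ i → x i t) (λ i → v-nonneg i t)
    (λ i → proj₁ (proj₁ max) i t) (proj₂ (proj₁ max) t) optimal
    (λ i _ → subst (0ℚ <_) (sym (final≡ i)) (0<u i)) using (equilibrium)

  envy-free-price : ∀ {i} k → 0ℚ < x i t → v k t * utility I x i ≤ v i t * utility I x k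
  envy-free-price {i} k 0<x = by-cases (≤-split (v-nonneg k t))
    where
    by-cases : 0ℚ < v k t ⊎ 0ℚ ≡ v k t → v k t * utility I x i ≤ v i t * utility I x k
    by-cases (inj₁ 0<v) = subst₂ (λ p q → v k t * p ≤ v i t * q) (final≡ i) (final≡ k) (equilibrium refl 0<v 0<x)
    by-cases (inj₂ 0≡v) = ≤-trans (≤-reflexive (trans (cong (_* utility I x i) (sym 0≡v)) (*-zeroˡ (utility I x i))))
      (*-nonneg (v-nonneg i t) (<⇒≤ (0<u k)))

Max-nonneg : ∀ {n} {f : Fin n → ℚ} → (∀ i → 0ℚ ≤ f i) → 0ℚ ≤ Max f
Max-nonneg {zero}      h = ≤-refl
Max-nonneg {suc n} {f} h = ≤-trans (h fzero) (p≤p⊔q (f fzero) (Max (f ∘ fsuc)))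

^-mono : ∀ {a b} → 0ℚ ≤ a → a ≤ b → ∀ n → a ^ n ≤ b ^ n
^-mono 0≤a a≤b zero    = ≤-refl
^-mono 0≤a a≤b (suc n) = *-mono 0≤a (^-nonneg (≤-trans 0≤a a≤b) n) a≤b (^-mono 0≤a a≤b n)

-- Levels along a greedy run

module Analysis {N T} (I : Instance N T) (ℓ : ℕ) {z : Fin N → Fin T → Fin (suc ℓ) → ℚ}
  (run : IsRoundedGreedyRun I (suc ℓ) z) where
  open Instance I

  L : ℕ
  L = suc ℓ

  r : Fin N → Fin T → Fin L → ℚ
  r = roundedValue I L

  thr : Fin T → Fin L → ℚ
  thr t j = vbar I t * (½ ^ suc (toℕ j))

  prior : Fin N → Fin T → Fin L → ℚ
  prior = priorUtility I L z

  vbar-nonneg : ∀ t → 0ℚ ≤ vbar I t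
  vbar-nonneg t = Max-nonneg (λ i → v-nonneg i t)

  thr-nonneg : ∀ t j → 0ℚ ≤ thr t j
  thr-nonneg t j = *-nonneg (vbar-nonneg t) (^-nonneg ½-nonneg (suc (toℕ j)))

  r-nonneg : ∀ i t j → 0ℚ ≤ r i t j
  r-nonneg i t j = keep-nonneg (v i t) (thr-nonneg t j)

  z-nonneg : ∀ i t j → 0ℚ ≤ z i t j
  z-nonneg i t j = proj₁ (proj₁ (run t j)) i

  gain : Fin N → Fin T → Fin L → ℚ
  gain i t j = r i t j * z i t j

  gain-nonneg : ∀ i t j → 0ℚ ≤ gain i t j
  gain-nonneg i t j = *-nonneg (r-nonneg i t j) (z-nonneg i t j)

  earlier : Fin N → Fin T → ℚ
  earlier i t = ΣBelow t (λ t′ → Σ (gain i t′))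

  prior-nonneg : ∀ i t j → 0ℚ ≤ prior i t j
  prior-nonneg i t j = +-nonneg (ΣBelow-nonneg t (λ t′ → Σ-nonneg (gain-nonneg i t′))) (ΣBelow-nonneg j (gain-nonneg i t))

  roundedUtility : Fin N → ℚ
  roundedUtility i = Σ (λ t → Σ (gain i t))

  roundedUtility-nonneg : ∀ i → 0ℚ ≤ roundedUtility i
  roundedUtility-nonneg i = Σ-nonneg (λ t → Σ-nonneg (gain-nonneg i t))

  prior+gain : ∀ i t j → prior i t j + gain i t j ≡ earlier i t + (ΣBelow j (gain i t) + gain i t j)
  prior+gain i t j = +-assoc (earlier i t) (ΣBelow j (gain i t)) (gain i t j)

  prior+gain≤ : ∀ i t j → prior i t j + gain i t j ≤ roundedUtility i
  prior+gain≤ i t j = ≤-trans (≤-reflexive (prior+gain i t j))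
    (≤-trans (+-monoʳ-≤ (earlier i t) (ΣBelow+term≤Σ j (gain-nonneg i t)))
      (ΣBelow+term≤Σ t (λ t′ → Σ-nonneg (gain-nonneg i t′))))

  -- Successive levels of one agent climb from 0 to `roundedUtility i` without gaps, so the parts of
  -- the climb below `c` telescope to `c ⊓ roundedUtility i`.
  capped-total : ∀ {c} → 0ℚ ≤ c → ∀ i →
    Σ (λ t → Σ (λ j → c ⊓ (prior i t j + gain i t j) - c ⊓ prior i t j)) ≤ c
  capped-total {c} 0≤c i = begin
    Σ (λ t → Σ (λ j → c ⊓ (prior i t j + gain i t j) - c ⊓ prior i t j))
      ≡⟨ Σ-cong (λ t → trans (Σ-cong (λ j → cong (λ p → c ⊓ p - c ⊓ prior i t j) (prior+gain i t j)))
           (trans (ΣBelow-telescope (λ a → c ⊓ (earlier i t + a)) (gain i t))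
             (cong (λ p → c ⊓ (earlier i t + Σ (gain i t)) - c ⊓ p) (+-identityʳ (earlier i t))))) ⟩
    Σ (λ t → c ⊓ (earlier i t + Σ (gain i t)) - c ⊓ earlier i t)
      ≡⟨ ΣBelow-telescope (c ⊓_) (λ t → Σ (gain i t)) ⟩
    c ⊓ roundedUtility i - c ⊓ 0ℚ
      ≡⟨ cong (λ p → c ⊓ roundedUtility i - p) (p≥q⇒p⊓q≡q 0≤c) ⟩
    c ⊓ roundedUtility i - 0ℚ
      ≡⟨ +-identityʳ (c ⊓ roundedUtility i) ⟩
    c ⊓ roundedUtility i
      ≤⟨ p⊓q≤p c (roundedUtility i) ⟩
    c ∎
    where open ≤-Reasoning

  roundedUtility≤utility : ∀ i → roundedUtility i ≤ utility I (roundedAllocation z) i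
  roundedUtility≤utility i = Σ-mono (λ t → ≤-trans
    (Σ-mono (λ j → ≤-trans (≤-reflexive (*-comm (r i t j) (z i t j))) (*-monoˡ (z-nonneg i t j) (keep≤ {v i t} {thr t j} (v-nonneg i t)))))
    (≤-reflexive (Σ-*ʳ (v i t) (z i t))))

  sub-supply-pos : ∀ t → 0ℚ < subSupply I L t
  sub-supply-pos t = *-pos (s-pos t) (recipℕ-pos ℓ)

  -- Spreading x evenly over the sub-items is feasible for the rounded instance.
  spread-bound : ∀ {x} → IsAllocation I x → ∀ {c} → 0ℚ ≤ c →
    Σ (λ t → Σ (λ j → Σ (λ i → if ⌊ roundedUtility i ≤? c ⌋ then r i t j * (x i t * recipℕ L) else 0ℚ))) ≤ ι N * c
  spread-bound {x} (0≤x , Σx≤s) {c} 0≤c = begin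
    Σ (λ t → Σ (λ j → Σ (λ i → if ⌊ roundedUtility i ≤? c ⌋ then r i t j * (x i t * recipℕ L) else 0ℚ)))
      ≤⟨ Σ-mono (λ t → Σ-mono (λ j → charge t j)) ⟩
    Σ (λ t → Σ (λ j → Σ (λ i → inc i t j)))
      ≡⟨ trans (Σ-cong (λ t → Σ-swap (λ j i → inc i t j))) (Σ-swap (λ t i → Σ (inc i t))) ⟩
    Σ (λ i → Σ (λ t → Σ (λ j → inc i t j)))
      ≤⟨ Σ-mono (capped-total 0≤c) ⟩
    Σ {N} (λ _ → c)
      ≡⟨ Σ-const N c ⟩
    ι N * c ∎
    where
    open ≤-Reasoning
    inc : Fin N → Fin T → Fin L → ℚ
    inc i t j = c ⊓ (prior i t j + gain i t j) - c ⊓ prior i t j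
    charge : ∀ t j → Σ (λ i → if ⌊ roundedUtility i ≤? c ⌋ then r i t j * (x i t * recipℕ L) else 0ℚ) ≤ Σ (λ i → inc i t j)
    charge t j = greedy-charge (λ i → x i t * recipℕ L) roundedUtility c (λ i → prior-nonneg i t j) (thr-nonneg t j)
      (λ i → keep-two-valued (v i t) (thr t j)) (sub-supply-pos t) (run t j)
      (λ i → *-nonneg (0≤x i t) (<⇒≤ (recipℕ-pos ℓ)))
      (≤-trans (≤-reflexive (Σ-*ʳ (recipℕ L) (λ i → x i t))) (*-monoʳ (<⇒≤ (recipℕ-pos ℓ)) (Σx≤s t)))
      (λ i → prior+gain≤ i t j)

  module AgainstMaximizer {x μ} (max : IsNWMaximizer I x) (0<u : ∀ i → 0ℚ < utility I x i)
    (μ≤2^L : μ ≤ 2ℚ ^ L) (impartial : Impartial μ I x) where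

    w : Fin N → ℚ
    w = utility I x

    0≤x : ∀ i t → 0ℚ ≤ x i t
    0≤x = proj₁ (proj₁ max)

    vbar≤ : ∀ {i t} → 0ℚ < x i t → vbar I t ≤ 2ℚ ^ L * v i t
    vbar≤ {i} {t} 0<x = Max-least (*-nonneg (^-nonneg (<⇒≤ 0<2) L) (v-nonneg i t)) (λ k →
      *-cancelˡ-≤ (0<u i) (begin
        w i * v k t           ≡⟨ *-comm (w i) (v k t) ⟩
        v k t * w i           ≤⟨ MaximizerColumn.envy-free-price I max 0<u t k 0<x ⟩
        v i t * w k           ≤⟨ *-monoˡ (v-nonneg i t) (≤-trans (impartial k i) (*-monoʳ (<⇒≤ (0<u i)) μ≤2^L)) ⟩
        v i t * (2ℚ ^ L * w i) ≡⟨ solve 3 (λ v p w → v :* (p :* w) := w :* (p :* v)) refl (v i t) (2ℚ ^ L) (w i) ⟩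
        w i * (2ℚ ^ L * v i t) ∎))
      where open ≤-Reasoning

    spread : Fin N → Fin T → Fin L → ℚ
    spread i t j = r i t j * (x i t * recipℕ L)

    covered : ∀ i t → x i t * v i t ≤ 2ℚ * ι L * Σ (spread i t)
    covered i t = by-cases (≤-split (0≤x i t))
      where
      open ≤-Reasoning
      by-cases : 0ℚ < x i t ⊎ 0ℚ ≡ x i t → x i t * v i t ≤ 2ℚ * ι L * Σ (spread i t)
      by-cases (inj₂ 0≡x) = ≤-trans (≤-reflexive (trans (cong (_* v i t) (sym 0≡x)) (*-zeroˡ (v i t))))
        (*-nonneg (*-nonneg (<⇒≤ 0<2) (ι-nonneg L))
          (Σ-nonneg (λ j → *-nonneg (r-nonneg i t j) (*-nonneg (0≤x i t) (<⇒≤ (recipℕ-pos ℓ))))))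
      by-cases (inj₁ 0<x) = begin
        x i t * v i t
          ≤⟨ *-monoˡ (0≤x i t) (rounding-covers ℓ (vbar-nonneg t) (Max-upper (λ i → v i t) i) (vbar≤ 0<x)) ⟩
        x i t * (2ℚ * Σ (r i t))
          ≡⟨ sym (*-identityˡ _) ⟩
        1ℚ * (x i t * (2ℚ * Σ (r i t)))
          ≡⟨ cong (_* (x i t * (2ℚ * Σ (r i t)))) (sym (recipℕ-inverse ℓ)) ⟩
        ι L * recipℕ L * (x i t * (2ℚ * Σ (r i t)))
          ≡⟨ solve 4 (λ l b x s → l :* b :* (x :* (con 2ℚ :* s)) := con 2ℚ :* l :* (s :* (x :* b))) refl
               (ι L) (recipℕ L) (x i t) (Σ (r i t)) ⟩
        2ℚ * ι L * (Σ (r i t) * (x i t * recipℕ L))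
          ≡⟨ cong (2ℚ * ι L *_) (sym (Σ-*ʳ (x i t * recipℕ L) (r i t))) ⟩
        2ℚ * ι L * Σ (spread i t) ∎

    -- The factor `2ℚ * ι L` is the price of rounding and splitting from `covered`; `ι N` counts the
    -- agents, each of which can absorb at most the level itself in `spread-bound`.
    H : ℚ
    H = 2ℚ * ι L * ι N

    rank-bound : ∀ i → rankWeight w roundedUtility (roundedUtility i) ≤ H * roundedUtility i
    rank-bound i = begin
      rankWeight w roundedUtility c
        ≤⟨ Σ-mono (λ k → below k (roundedUtility k ≤? c)) ⟩
      Σ (λ k → 2ℚ * ι L * Σ (λ t → Σ (λ j → masked k t j)))
        ≡⟨ Σ-*ˡ (2ℚ * ι L) (λ k → Σ (λ t → Σ (λ j → masked k t j))) ⟩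
      2ℚ * ι L * Σ (λ k → Σ (λ t → Σ (λ j → masked k t j)))
        ≡⟨ cong (2ℚ * ι L *_) (trans (Σ-swap (λ k t → Σ (masked k t))) (Σ-cong (λ t → Σ-swap (λ k j → masked k t j)))) ⟩
      2ℚ * ι L * Σ (λ t → Σ (λ j → Σ (λ k → masked k t j)))
        ≤⟨ *-monoˡ (*-nonneg (<⇒≤ 0<2) (ι-nonneg L)) (spread-bound (proj₁ max) (roundedUtility-nonneg i)) ⟩
      2ℚ * ι L * (ι N * c)
        ≡⟨ sym (*-assoc (2ℚ * ι L) (ι N) c) ⟩
      H * c ∎
      where
      open ≤-Reasoning
      c : ℚ
      c = roundedUtility i
      masked : Fin N → Fin T → Fin L → ℚ
      masked k t j = if ⌊ roundedUtility k ≤? c ⌋ then spread k t j else 0ℚ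
      below : ∀ k → Dec (roundedUtility k ≤ c) →
        (if ⌊ roundedUtility k ≤? c ⌋ then w k else 0ℚ) ≤ 2ℚ * ι L * Σ (λ t → Σ (λ j → masked k t j))
      below k (yes le) = begin
        (if ⌊ roundedUtility k ≤? c ⌋ then w k else 0ℚ)  ≡⟨ if-yes (roundedUtility k ≤? c) le ⟩
        w k                                              ≤⟨ Σ-mono (covered k) ⟩
        Σ (λ t → 2ℚ * ι L * Σ (spread k t))              ≡⟨ Σ-*ˡ (2ℚ * ι L) (λ t → Σ (spread k t)) ⟩
        2ℚ * ι L * Σ (λ t → Σ (spread k t))              ≡⟨ cong (2ℚ * ι L *_) (Σ-cong {T} (λ t → Σ-cong {L} (λ j → sym (if-yes {x = spread k t j} {0ℚ} (roundedUtility k ≤? c) le)))) ⟩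
        2ℚ * ι L * Σ (λ t → Σ (λ j → masked k t j))      ∎
      below k (no ≰) = ≤-reflexive (trans (if-no (roundedUtility k ≤? c) ≰) (sym (trans
        (cong (2ℚ * ι L *_) (Σ-zero {T} (λ t → Σ-zero {L} (λ j → if-no {x = spread k t j} (roundedUtility k ≤? c) ≰)))) (*-zeroʳ (2ℚ * ι L)))))

    ratio : ∀ i j → w i ≤ 2ℚ ^ L * w j
    ratio i j = ≤-trans (impartial i j) (*-monoʳ (<⇒≤ (0<u j)) μ≤2^L)

    -- Arises from 2(L + 1) · 2L ≤ 8L², where L + 1 ≤ 2L because `L` is `suc ℓ`. The other factor
    -- `4ℚ` is the cost of trading `ι N ^ N` for `fact N`.
    8ℚ : ℚ
    8ℚ = ℕtoℚ 8

    welfare-bound : NWpow I x ≤ (8ℚ * 4ℚ * (ι L * ι L)) ^ N * NWpow I (roundedAllocation z)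
    welfare-bound = *-cancelˡ-≤ (fact-pos N) (begin
      fact N * Π w
        ≤⟨ Π-rank-bound L N w roundedUtility (*-nonneg (*-nonneg (<⇒≤ 0<2) (ι-nonneg L)) (ι-nonneg N)) 0<u roundedUtility-nonneg ratio rank-bound ⟩
      (2ℚ * ι (suc L) * H) ^ N * Π roundedUtility
        ≤⟨ *-mono (^-nonneg 0≤base N) (Π-nonneg utility-nonneg) (^-mono 0≤base base≤ N) (Π-mono roundedUtility-nonneg roundedUtility≤utility) ⟩
      (8ℚ * (ι L * ι L) * ι N) ^ N * P
        ≡⟨ cong (_* P) (^-*-distrib (8ℚ * (ι L * ι L)) (ι N) N) ⟩
      (8ℚ * (ι L * ι L)) ^ N * ι N ^ N * P
        ≤⟨ *-monoʳ (Π-nonneg utility-nonneg) (*-monoˡ (^-nonneg 0≤8L² N) (n^n≤4^n*n! N)) ⟩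
      (8ℚ * (ι L * ι L)) ^ N * (4ℚ ^ N * fact N) * P
        ≡⟨ solve 4 (λ a b f p → a :* (b :* f) :* p := f :* (a :* b :* p)) refl ((8ℚ * (ι L * ι L)) ^ N) (4ℚ ^ N) (fact N) P ⟩
      fact N * ((8ℚ * (ι L * ι L)) ^ N * 4ℚ ^ N * P)
        ≡⟨ cong (λ q → fact N * (q * P)) (trans (sym (^-*-distrib (8ℚ * (ι L * ι L)) 4ℚ N))
             (cong (_^ N) (solve 3 (λ e f l → e :* l :* f := e :* f :* l) refl 8ℚ 4ℚ (ι L * ι L)))) ⟩
      fact N * ((8ℚ * 4ℚ * (ι L * ι L)) ^ N * P) ∎)
      where
      open ≤-Reasoning
      P : ℚ
      P = NWpow I (roundedAllocation z)
      utility-nonneg : ∀ i → 0ℚ ≤ utility I (roundedAllocation z) i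
      utility-nonneg i = ≤-trans (roundedUtility-nonneg i) (roundedUtility≤utility i)
      0≤8L² : 0ℚ ≤ 8ℚ * (ι L * ι L)
      0≤8L² = *-nonneg (nonNegative⁻¹ 8ℚ) (*-nonneg (ι-nonneg L) (ι-nonneg L))
      0≤H : 0ℚ ≤ H
      0≤H = *-nonneg (*-nonneg (<⇒≤ 0<2) (ι-nonneg L)) (ι-nonneg N)
      0≤base : 0ℚ ≤ 2ℚ * ι (suc L) * H
      0≤base = *-nonneg (*-nonneg (<⇒≤ 0<2) (ι-nonneg (suc L))) 0≤H
      suc-L≤2L : ι (suc L) ≤ 2ℚ * ι L
      suc-L≤2L = ≤-by (ι ℓ) (ι-nonneg ℓ) (trans (cong (2ℚ *_) (ι-suc ℓ))
        (trans (solve 1 (λ l → con 2ℚ :* (con 1ℚ :+ l) := con 1ℚ :+ (con 1ℚ :+ l) :+ l) refl (ι ℓ))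
          (cong (_+ ι ℓ) (trans (cong (1ℚ +_) (sym (ι-suc ℓ))) (sym (ι-suc L))))))
      base≤ : 2ℚ * ι (suc L) * H ≤ 8ℚ * (ι L * ι L) * ι N
      base≤ = ≤-trans (*-monoʳ 0≤H (*-monoˡ (<⇒≤ 0<2) suc-L≤2L))
        (≤-reflexive (solve 2 (λ l n → con 2ℚ :* (con 2ℚ :* l) :* (con 2ℚ :* l :* n) := con 8ℚ :* (l :* l) :* n) refl (ι L) (ι N)))

-- The competitive ratio

1<2 : 1ℚ < ℕtoℚ 2
1<2 = <-by 1ℚ 0<1 refl

32ℚ : ℚ
32ℚ = ℕtoℚ 32

competitive-against : ∀ {N T} (I : Instance N T) (μ : ℚ) (L : ℕ) → ℕtoℚ 2 ≤ μ → IsCeilLog2 μ L → ImpartialInstance μ I →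
  (z : Fin N → Fin T → Fin L → ℚ) → IsRoundedGreedyRun I L z → ∀ {x} → IsNWMaximizer I x →
  NWpow I x ≤ ((32ℚ * (ℕtoℚ L * ℕtoℚ L)) ^ N) * NWpow I (roundedAllocation z)
competitive-against I μ zero 2≤μ (μ≤1 , _) _ z run max = ⊥-elim (<-irrefl refl (<-≤-trans 1<2 (≤-trans 2≤μ μ≤1)))
competitive-against {N} {T} I μ (suc ℓ) 2≤μ (μ≤2^L , _) impartial z run {x} max =
  subst (λ l → NWpow I x ≤ ((32ℚ * (l * l)) ^ N) * P) (ι≡ℕtoℚ (suc ℓ)) (by-cases (≤-split (Π-nonneg 0≤u)))
  where
  open Analysis I ℓ run
  P : ℚ
  P = NWpow I (roundedAllocation z)
  0≤u : ∀ i → 0ℚ ≤ utility I x i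
  0≤u i = Σ-nonneg (λ t → *-nonneg (proj₁ (proj₁ max) i t) (Instance.v-nonneg I i t))
  by-cases : 0ℚ < NWpow I x ⊎ 0ℚ ≡ NWpow I x → NWpow I x ≤ ((32ℚ * (ι (suc ℓ) * ι (suc ℓ))) ^ N) * P
  -- The first-order conditions are available once all optimal utilities are positive; if the
  -- optimal product is zero, the bound is immediate. The constant `8ℚ * 4ℚ` computes to `32ℚ`.
  by-cases (inj₁ 0<Π) = AgainstMaximizer.welfare-bound max (Π>0⇒factor>0 0≤u 0<Π) μ≤2^L (impartial x max)
  by-cases (inj₂ 0≡Π) = ≤-trans (≤-reflexive (sym 0≡Π)) (*-nonneg
    (^-nonneg (*-nonneg (nonNegative⁻¹ 32ℚ) (*-nonneg (ι-nonneg (suc ℓ)) (ι-nonneg (suc ℓ)))) N)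
    (Π-nonneg (λ i → ≤-trans (roundedUtility-nonneg i) (roundedUtility≤utility i))))

competitive : ∀ {N T} (I : Instance N T) (μ : ℚ) (L : ℕ) → ℕtoℚ 2 ≤ μ → IsCeilLog2 μ L → ImpartialInstance μ I →
  (z : Fin N → Fin T → Fin L → ℚ) → IsRoundedGreedyRun I L z → (y : Fin N → Fin T → ℚ) → IsAllocation I y →
  NWpow I y ≤ ((32ℚ * (ℕtoℚ L * ℕtoℚ L)) ^ N) * NWpow I (roundedAllocation z)
-- Without agents all products are empty and both sides compute to 1. `maximizer-exists` wants an
-- agent that can take the leftover supply.
competitive {zero}  I μ L 2≤μ log impartial z run y alloc = ≤-refl
competitive {suc n} I μ L 2≤μ log impartial z run y alloc = decidable-stable (_ ≤? _) (λ ¬bound →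
  maximizer-exists I (λ { (x , max) → ¬bound (≤-trans (proj₂ max y alloc) (competitive-against I μ L 2≤μ log impartial z run max)) }))

theorem5 : Σ[ C ∈ ℚ ] (0ℚ < C ×
    (∀ {N T : ℕ} (I : Instance N T) (μ : ℚ) (L : ℕ) →
    ℕtoℚ 2 ≤ μ → IsCeilLog2 μ L → ImpartialInstance μ I →
    (z : Fin N → Fin T → Fin L → ℚ) → IsRoundedGreedyRun I L z →
    (y : Fin N → Fin T → ℚ) → IsAllocation I y →
    NWpow I y ≤ ((C * (ℕtoℚ L * ℕtoℚ L)) ^ N) * NWpow I (roundedAllocation z)))
theorem5 = 32ℚ , positive⁻¹ 32ℚ , competitive
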